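{- Let $\boldsymbol M=(M_1,\dots,M_k)$ be a flag matroid on $[n]$ and let $w:\mathcal B(M_1)\times\cdots\times\mathcal B(M_k)\to\mathbb R$ be a weight on its base configuration such that the coherent subdivision $\Delta_w$ is flag matroidal. Let $\mu_i:\mathcal B(M_i)\to\mathbb R$ ($1\le i\le k$) be any weights such that $\Delta_w=\Delta_{\sum_{i=1}^k\mu_i}$, where $(\sum_i\mu_i)(B_1,\dots,B_k)=\sum_i\mu_i(B_i)$. Then each $\mu_i$ (extended by $\infty$ to $\binom{[n]}{\operatorname{rk}M_i}$) is a valuated matroid, and $\overline{\operatorname{trop}}(\mu_1)\subseteq\cdots\subseteq\overline{\operatorname{trop}}(\mu_k)$.
   Context: $\mathbb T=\mathbb R\cup\{\infty\}$; $\mathbf e_B=\sum_{i\in B}\mathbf e_i$. A flag matroid is a sequence $(N_1,\dots,N_k)$ of matroids on $[n]$ such that for all $i<j$ every circuit of $N_j$ is a union of circuits of $N_i$. For a weight $w$ on $\mathcal B(M_1)\times\cdots\times\mathcal B(M_k)$ and $u\in\mathbb R^n$, let $\Delta_w^u$ be the set of tuples $(B_1,\dots,B_k)$ minimizing $w(B_1,\dots,B_k)+\langle u,\sum_i\mathbf e_{B_i}\rangle$; the coherent subdivision $\Delta_w$ is the collection $\{\Delta_w^u:u\in\mathbb R^n\}$. It is flag matroidal if every $\Delta_w^u$ equals $\mathcal B(N_1)\times\cdots\times\mathcal B(N_k)$ for some flag matroid $(N_1,\dots,N_k)$. A valuated matroid of rank $r$ on a finite set $E$ is $\mu:\binom{E}{r}\to\mathbb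 T$ such that $\mathcal B(M)=\{I:\mu(I)\ne\infty\}$ is the set of bases of a matroid $M$ and for all $B,B'\in\mathcal B(M)$, $i\in B\setminus B'$ there is $j\in B'\setminus B$ with $\mu(B)+\mu(B')\ge\mu(B\setminus i\cup j)+\mu(B'\setminus j\cup i)$. For $S\subseteq E$ let $\mathcal B_S$ be the bases $B$ with $|B\cap S|$ maximal; the contraction $\mu/_S$ (ground set $E\setminus S$, finite exactly on bases of $M/_S$) and restriction $\mu|_S$ are the valuated matroids, unique up to additive constants, with $\mu(B)=\mu|_S(B\cap S)+\mu/_S(B\setminus S)$ for $B\in\mathcal B_S$. Valuated circuits: vectors $\mathbf C_\mu(S)$, $S\in\binom{E}{r+1}$, with coordinates $\mu(S\setminus i)$ for $i\in S$ and $\infty$ otherwise, excluding all-$\infty$. $\operatorname{trop}(\mu)\subseteq\mathbb R^E/\mathbb R\mathbf 1$ is the set of $\bar u$ such that for every valuated circuit $\mathbf C$ the minimum of $\{C_i+u_i:C_i\neq\infty\}$ is attained at least twice. $\mathbb P(\mathbb T^{[n]})$ is $\mathbb T^{[n]}$ minus the all-$\infty$ vector, modulo adding real multiples of $\mathbf 1$; the projective tropical linear space is $\overline{\operatorname{trop}}(\mu)=\bigcup_{\emptyset\subseteq S\subsetneq[n]}\operatorname{trop}(\mu/_S)\times\{\infty\}^S\subseteq\mathbb P(\mathbb T^{[n]})$. -}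

module Defs where

open import Data.Nat using (ℕ; zero; suc)
open import Data.Bool using (Bool; true; false; if_then_else_; T)
open import Data.Fin using (Fin; zero; suc)
open import Data.Fin.Subset using (Subset; _∈_; _∉_; _⊆_; _⊂_; _∩_; _∪_; _─_; _-_; ∁; ⁅_⁆; ∣_∣)
open import Data.Vec using (lookup; tabulate)
open import Data.Maybe using (Maybe; just; nothing; is-nothing)
open import Data.Product using (Σ; ∃; ∃-syntax; _×_; _,_)
open import Relation.Nullary using (¬_)
open import Relation.Binary.PropositionalEquality using (_≡_; _≢_)
open import Relation.Binary.Structures using (IsDecTotalOrder)
open import Algebra.Structures using (IsAbelianGroup)
import Data.Nat as ℕ

-- The real line (ℝ, +, ≤), axiomatised up to isomorphism:
-- a nontrivial, densely ordered, Dedekind-complete ordered abelian group.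
-- (By Hölder's theorem every model is isomorphic to (ℝ,+,≤).)
-- Decidability of ≤ is classically true of ℝ.

record RealLine : Set₁ where
  infixl 6 _+_
  infix 4 _≤_ _<_
  field
    ℝ       : Set
    _+_     : ℝ → ℝ → ℝ
    0ℝ      : ℝ
    neg     : ℝ → ℝ
    _≤_     : ℝ → ℝ → Set
    isAbelianGroup : IsAbelianGroup _≡_ _+_ 0ℝ neg
    isDecTotalOrder : IsDecTotalOrder _≡_ _≤_
    +-mono  : ∀ {a b} c → a ≤ b → a + c ≤ b + c
  _<_ : ℝ → ℝ → Set
  a < b = a ≤ b × a ≢ b
  field
    dense      : ∀ {a b} → a < b → ∃[ c ] (a < c × c < b)
    nontrivial : ∃[ a ] (0ℝ < a)
    complete   : (P : ℝ → Set) → ∃ P → (∃[ b ] (∀ x → P x → x ≤ b)) →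
                 ∃[ s ] ((∀ x → P x → x ≤ s) × (∀ b → (∀ x → P x → x ≤ b) → s ≤ b))

record Matroid (n : ℕ) : Set where
  field
    isBasis  : Subset n → Bool
  IsBasis : Subset n → Set
  IsBasis B = T (isBasis B)
  field
    nonempty : ∃[ B ] IsBasis B
    exchange : ∀ B B′ → IsBasis B → IsBasis B′ → ∀ i → i ∈ B → i ∉ B′ →
               ∃[ j ] (j ∈ B′ × j ∉ B × IsBasis ((B - i) ∪ ⁅ j ⁆))

open Matroid public

Independent : ∀ {n} → Matroid n → Subset n → Set
Independent M I = ∃[ B ] (IsBasis M B × I ⊆ B)

Circuit : ∀ {n} → Matroid n → Subset n → Set
Circuit M C = ¬ Independent M C × (∀ D → D ⊂ C → Independent M D)

-- (N_1,…,N_k) is a flag matroid: for i<j every circuit of N_j is a union of circuits of N_i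
IsFlag : ∀ {n k} → (Fin k → Matroid n) → Set
IsFlag {n} {k} N = ∀ (i j : Fin k) → Data.Fin._<_ i j → ∀ C → Circuit (N j) C →
  ∀ e → e ∈ C → ∃[ D ] (Circuit (N i) D × e ∈ D × D ⊆ C)

InConfig : ∀ {n k} → (Fin k → Matroid n) → (Fin k → Subset n) → Set
InConfig M B = ∀ i → IsBasis (M i) (B i)

_⇔_ : Set → Set → Set
A ⇔ B = (A → B) × (B → A)

module _ (R : RealLine) where
  open RealLine R

  ∑ : ∀ {m} → (Fin m → ℝ) → ℝ
  ∑ {zero}  f = 0ℝ
  ∑ {suc m} f = f zero + ∑ (λ i → f (suc i))

  pairSet : ∀ {n} → (Fin n → ℝ) → Subset n → ℝ
  pairSet u B = ∑ (λ j → if lookup B j then u j else 0ℝ)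

  pair : ∀ {n k} → (Fin n → ℝ) → (Fin k → Subset n) → ℝ
  pair u B = ∑ (λ i → pairSet u (B i))

  Cell : ∀ {n k} → (Fin k → Matroid n) → ((Fin k → Subset n) → ℝ) → (Fin n → ℝ) →
         (Fin k → Subset n) → Set
  Cell M w u B = InConfig M B ×
    (∀ B′ → InConfig M B′ → w B + pair u B ≤ w B′ + pair u B′)

  FlagMatroidal : ∀ {n k} → (Fin k → Matroid n) → ((Fin k → Subset n) → ℝ) → Set
  FlagMatroidal {n} {k} M w = ∀ (u : Fin n → ℝ) →
    ∃[ N ] (IsFlag {n} {k} N × (∀ B → Cell M w u B ⇔ (∀ i → IsBasis (N i) (B i))))

  -- Δ_w = Δ_v as collections of cells {Δ^u : u ∈ ℝ^n}
  SameSubdivision : ∀ {n k} → (Fin k → Matroid n) → (w v : (Fin k → Subset n) → ℝ) → Set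
  SameSubdivision M w v =
    (∀ u → ∃[ u′ ] (∀ B → Cell M w u B ⇔ Cell M v u′ B)) ×
    (∀ u → ∃[ u′ ] (∀ B → Cell M v u B ⇔ Cell M w u′ B))

  sumWeight : ∀ {n k} → (Fin k → Subset n → ℝ) → (Fin k → Subset n) → ℝ
  sumWeight μ B = ∑ (λ i → μ i (B i))

  -- 𝕋 = ℝ ∪ {∞}, with ∞ = nothing

  𝕋 : Set
  𝕋 = Maybe ℝ

  Finite : 𝕋 → Set
  Finite x = ∃[ a ] (x ≡ just a)

  _⊕_ : 𝕋 → 𝕋 → 𝕋
  just a ⊕ just b = just (a + b)
  _      ⊕ _      = nothing

  data _≤𝕋_ : 𝕋 → 𝕋 → Set where
    fin≤fin : ∀ {a b} → a ≤ b → just a ≤𝕋 just b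
    _≤∞     : ∀ x → x ≤𝕋 nothing

  extend : ∀ {n} → Matroid n → (Subset n → ℝ) → Subset n → 𝕋
  extend M μ B = if isBasis M B then just (μ B) else nothing

  IsValuatedMatroid : ∀ {n} → (Subset n → 𝕋) → Set
  IsValuatedMatroid {n} μ =
    (∃[ N ] (∀ B → Finite (μ B) ⇔ IsBasis {n} N B)) ×
    (∀ B B′ → Finite (μ B) → Finite (μ B′) → ∀ i → i ∈ B → i ∉ B′ →
      ∃[ j ] (j ∈ B′ × j ∉ B ×
        (μ ((B - i) ∪ ⁅ j ⁆) ⊕ μ ((B′ - j) ∪ ⁅ i ⁆)) ≤𝕋 (μ B ⊕ μ B′)))

  InBS : ∀ {n} → (Subset n → 𝕋) → Subset n → Subset n → Set
  InBS μ S B = Finite (μ B) × (∀ B′ → Finite (μ B′) → ∣ B′ ∩ S ∣ ℕ.≤ ∣ B ∩ S ∣)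

  -- ν is (a representative of) the contraction μ/_S, viewed on subsets of E∖S
  IsContraction : ∀ {n} → (Subset n → 𝕋) → Subset n → (Subset n → 𝕋) → Set
  IsContraction μ S ν =
    (∀ A → A ⊆ ∁ S → (Finite (ν A) ⇔ (∃[ B ] (InBS μ S B × A ≡ B ─ S)))) ×
    (Σ (Subset _ → ℝ) λ ρ → ∀ B → InBS μ S B → μ B ≡ (just (ρ (B ∩ S)) ⊕ ν (B ─ S)))

  -- ū ∈ trop(ν), ν a valuated matroid on E∖S: for every T ⊆ E∖S,
  -- the minimum over the finite coordinates of C_ν(T) + u is attained twice
  InTrop : ∀ {n} → (Subset n → 𝕋) → Subset n → (Fin n → ℝ) → Set
  InTrop {n} ν S u = ∀ (T′ : Subset n) → T′ ⊆ ∁ S →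
    let val : Fin n → 𝕋
        val i = ν (T′ - i) ⊕ just (u i)
    in (∃[ l ] (l ∈ T′ × Finite (val l))) →
       ∃[ i ] ∃[ j ] (i ∈ T′ × j ∈ T′ × i ≢ j × val i ≡ val j ×
                      (∀ l → l ∈ T′ → val i ≤𝕋 val l))

  InTropBar : ∀ {n} → (Subset n → 𝕋) → (Fin n → 𝕋) → Set
  InTropBar {n} μ x =
    (∃[ i ] Finite (x i)) ×
    (∃[ ν ] (IsContraction μ S ν ×
             InTrop ν S (λ i → Data.Maybe.fromMaybe 0ℝ (x i))))
    where
      S : Subset n
      S = tabulate (λ i → is-nothing (x i))

{-# OPTIONS --safe #-}
module Submission where

-- A cell of a sum of weights is the product of the cells of the summands, so for every u the sets
-- N_i(u) of minimisers of μ_i + u are the bases of matroids forming a flag.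
--
-- This alone makes μ_i a valuated matroid. First, a basis B that no single swap improves is a global
-- minimiser: B is one after a large bonus on its elements, and if lowering the bonus of b first
-- makes an X₀ without b equally good, exchanging b between B and X₀ in the initial matroid gives an
-- improving swap. Next, suppose the exchange axiom fails for B, B′ and i ∈ B ∖ B′, with |B ∖ B′|
-- least possible, and let k ∈ B ∖ B′ be another element. There is a weight v for which every
-- basis B − i + j with j ∈ B′ ∖ B is as good as B, B′ is locally, hence globally, minimal, some B″ = B′ − l + k is as
-- good as B′, but no B′ − j + i is. The exchange for (B, B″, i) makes some B″ − j + i minimal,
-- and the dual exchange axiom in N(v) between it and B′ makes some B′ − j′ + i minimal.
--
-- A point with infinite coordinates S and finite part u lies in the tropical linear space of μ_i
-- iff no element outside S is a loop of N_i(v), where v = −u off S and v = −L on S for a large L.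
-- In a flag every loop of N_j(v) is a loop of N_i(v) for i < j.

open import Defs
open import Algebra.Bundles using (AbelianGroup)
open import Data.Bool using (true; false; if_then_else_; T?)
open import Data.Empty using (⊥-elim)
open import Data.Fin using (Fin; zero; suc; _≤_) renaming (_<_ to _<ᶠ_)
open import Data.Fin.Properties using (_≟_; any?; ≤∧≢⇒<)
open import Data.Fin.Subset using (Subset; _∈_; _∉_; _⊆_; _⊂_; _∩_; _∪_; _─_; _-_; ∁; ⁅_⁆; ∣_∣)
open import Data.Fin.Subset.Properties
open import Data.Maybe using (just; is-nothing; fromMaybe)
open import Data.Maybe.Properties using (just-injective)
open import Data.Nat using (ℕ; zero; suc)
open import Data.Product using (∃-syntax; _×_; _,_; proj₁; proj₂)
open import Data.Sum using (_⊎_; inj₁; inj₂)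
open import Data.Unit using (⊤; tt)
open import Data.Vec using (Vec; []; _∷_; lookup; tabulate; here; there)
open import Data.Vec.Properties using (lookup⇒[]=; []=⇒lookup)
open import Function using (_∘_; id; case_of_)
open import Relation.Binary.PropositionalEquality using (_≡_; _≢_; refl; sym; trans; cong; cong₂; subst; subst₂; setoid; module ≡-Reasoning)
open import Relation.Binary.Structures using (IsDecTotalOrder)
open import Relation.Nullary using (¬_; Dec; yes; no; does)
open import Relation.Nullary.Decidable using (_×-dec_; ¬?; dec-true; dec-false)
import Algebra.Properties.CommutativeMonoid.Mult as Mult
import Algebra.Properties.AbelianGroup as AbelianGroupProperties
import Algebra.Properties.CommutativeSemigroup as CommutativeSemigroupProperties
import Data.Nat as ℕ
import Data.Nat.Properties as ℕₚ
import Data.Vec as Vec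
import Relation.Binary.Reflection as Reflection

-- Conditionals

if-yes : ∀ {a} {A : Set a} {P : Set} (P? : Dec P) {x y : A} → P → (if does P? then x else y) ≡ x
if-yes P? p rewrite dec-true P? p = refl

if-no : ∀ {a} {A : Set a} {P : Set} (P? : Dec P) {x y : A} → ¬ P → (if does P? then x else y) ≡ y
if-no P? ¬p rewrite dec-false P? ¬p = refl

-- Subsets

∈─⁻ : ∀ {n} {e : Fin n} (p q : Subset n) → e ∈ p ─ q → e ∈ p × e ∉ q
∈─⁻ p q e∈ = p─q⊆p p q e∈ , disjoint p q e∈
  where
  disjoint : ∀ {n} {e : Fin n} (p q : Subset n) → e ∈ p ─ q → e ∉ q
  disjoint (_ ∷ p) (_ ∷ q) (there e∈) (there e∈q) = disjoint p q e∈ e∈q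

swap : ∀ {n} → Subset n → Fin n → Fin n → Subset n
swap B i j = (B - i) ∪ ⁅ j ⁆

module _ {n : ℕ} where

  ∈-minus⁻ : ∀ {e i : Fin n} (B : Subset n) → e ∈ B - i → e ∈ B × e ≢ i
  ∈-minus⁻ {i = i} B e∈ with ∈─⁻ B ⁅ i ⁆ e∈
  ... | e∈B , e∉ = e∈B , x∉⁅y⁆⇒x≢y e∉

  swap-new : ∀ (B : Subset n) i j → j ∈ swap B i j
  swap-new B i j = q⊆p∪q (B - i) ⁅ j ⁆ (x∈⁅x⁆ j)

  swap-old : ∀ {B : Subset n} {i e} j → e ∈ B → e ≢ i → e ∈ swap B i j
  swap-old j e∈B e≢i = p⊆p∪q ⁅ j ⁆ (x∈p∧x≢y⇒x∈p-y e∈B e≢i)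

  swap⁻ : ∀ {B : Subset n} {i j e} → e ∈ swap B i j → e ≡ j ⊎ (e ∈ B × e ≢ i)
  swap⁻ {B} {i} {j} e∈ with x∈p∪q⁻ (B - i) ⁅ j ⁆ e∈
  ... | inj₁ e∈- = inj₂ (∈-minus⁻ B e∈-)
  ... | inj₂ e∈j = inj₁ (x∈⁅y⁆⇒x≡y j e∈j)

  swap-out : ∀ {B : Subset n} {i j} → i ≢ j → i ∉ swap B i j
  swap-out i≢j i∈ with swap⁻ i∈
  ... | inj₁ i≡j       = i≢j i≡j
  ... | inj₂ (_ , i≢i) = i≢i refl

  ∈∉⇒≢ : ∀ {B : Subset n} {i j} → i ∈ B → j ∉ B → i ≢ j
  ∈∉⇒≢ i∈B j∉B refl = j∉B i∈B

  swap-involutive : ∀ {B : Subset n} {i j} → i ∈ B → j ∉ B → swap (swap B i j) j i ≡ B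
  swap-involutive {B} {i} {j} i∈B j∉B = ⊆-antisym to from
    where
    to : swap (swap B i j) j i ⊆ B
    to e∈ with swap⁻ e∈
    ... | inj₁ refl = i∈B
    ... | inj₂ (e∈′ , e≢j) with swap⁻ e∈′
    ...   | inj₁ e≡j       = ⊥-elim (e≢j e≡j)
    ...   | inj₂ (e∈B , _) = e∈B
    from : B ⊆ swap (swap B i j) j i
    from {e} e∈B with e ≟ i
    ... | yes refl = swap-new (swap B i j) j i
    ... | no e≢i   = swap-old i (swap-old j e∈B e≢i) (∈∉⇒≢ e∈B j∉B)

  lookup-∉ : ∀ {B : Subset n} {e} → e ∉ B → lookup B e ≡ false
  lookup-∉ {B} {e} e∉B with lookup B e in eq
  ... | true  = ⊥-elim (e∉B (lookup⇒[]= e B eq))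
  ... | false = refl

  if-∈ : ∀ {a} {A : Set a} {B : Subset n} {e} {x y : A} → e ∈ B → (if lookup B e then x else y) ≡ x
  if-∈ e∈B rewrite []=⇒lookup e∈B = refl

  if-∉ : ∀ {a} {A : Set a} {B : Subset n} {e} {x y : A} → e ∉ B → (if lookup B e then x else y) ≡ y
  if-∉ e∉B rewrite lookup-∉ e∉B = refl

  p⊆q∧∣q∣≤∣p∣⇒q⊆p : ∀ {p q : Subset n} → p ⊆ q → ∣ q ∣ ℕ.≤ ∣ p ∣ → q ⊆ p
  p⊆q∧∣q∣≤∣p∣⇒q⊆p {p} {q} p⊆q q≤p {e} e∈q with e ∈? p
  ... | yes e∈p = e∈p
  ... | no  e∉p = ⊥-elim (ℕₚ.<⇒≱ (p⊂q⇒∣p∣<∣q∣ (p⊆q , e , e∈q , e∉p)) q≤p)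

∣p∣≤1+∣p-x∣ : ∀ {n} (p : Subset n) x → ∣ p ∣ ℕ.≤ suc ∣ p - x ∣
∣p∣≤1+∣p-x∣ (true  ∷ p) zero    = ℕ.s≤s (ℕₚ.≤-reflexive (cong ∣_∣ (sym (p─⊥≡p p))))
∣p∣≤1+∣p-x∣ (false ∷ p) zero    = ℕₚ.m≤n⇒m≤1+n (ℕₚ.≤-reflexive (cong ∣_∣ (sym (p─⊥≡p p))))
∣p∣≤1+∣p-x∣ (true  ∷ p) (suc x) = ℕ.s≤s (∣p∣≤1+∣p-x∣ p x)
∣p∣≤1+∣p-x∣ (false ∷ p) (suc x) = ∣p∣≤1+∣p-x∣ p x

∣p∣≤∣swap∣ : ∀ {n} (p : Subset n) i {j} → j ∉ p → ∣ p ∣ ℕ.≤ ∣ swap p i j ∣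
∣p∣≤∣swap∣ p i {j} j∉p = ℕₚ.≤-trans (∣p∣≤1+∣p-x∣ p i)
  (p⊂q⇒∣p∣<∣q∣ (p⊆p∪q ⁅ j ⁆ , j , swap-new p i j , λ j∈ → j∉p (proj₁ (∈-minus⁻ p j∈))))

-- The case split of the inductions on `∣ B ─ B′ ∣` for bases: an element besides `i` allows a step
-- that shrinks the difference, and without one the bases are a single swap apart.
another-difference? : ∀ {n} (B B′ : Subset n) i →
  (∃[ e ] (e ∈ B × e ∉ B′ × e ≢ i)) ⊎ (∀ e → e ∈ B → e ∉ B′ → e ≡ i)
another-difference? B B′ i with any? (λ e → (e ∈? B) ×-dec (¬? (e ∈? B′) ×-dec ¬? (e ≟ i)))
... | yes found = inj₁ found
... | no none   = inj₂ λ e e∈B e∉B′ → case e ≟ i of λ where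
  (yes e≡i) → e≡i
  (no e≢i)  → ⊥-elim (none (e , e∈B , e∉B′ , e≢i))

-- Matroids

module _ {n : ℕ} (M : Matroid n) where

  nested-bases-equal : ∀ {B B′} → IsBasis M B → IsBasis M B′ → B ⊆ B′ → B ≡ B′
  nested-bases-equal {B} {B′} b b′ B⊆B′ = ⊆-antisym B⊆B′ λ {e} e∈B′ → in-B e e∈B′
    where
    in-B : ∀ e → e ∈ B′ → e ∈ B
    in-B e e∈B′ with e ∈? B
    ... | yes e∈B = e∈B
    ... | no e∉B with exchange M B′ B b′ b e e∈B′ e∉B
    ...   | j , j∈B , j∉B′ , _ = ⊥-elim (j∉B′ (B⊆B′ j∈B))

  -- Once `i` is exchanged, nothing of the swapped basis lies outside `B′`, and nested bases are
  -- equal.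
  unique-difference : ∀ {B B′} → IsBasis M B → IsBasis M B′ → ∀ {i} → i ∈ B → i ∉ B′ →
    (∀ e → e ∈ B → e ∉ B′ → e ≡ i) →
    ∃[ j ] (j ∈ B′ × j ∉ B × swap B i j ≡ B′ × swap B′ j i ≡ B)
  unique-difference {B} {B′} b b′ {i} i∈B i∉B′ only with exchange M B B′ b b′ i i∈B i∉B′
  ... | j , j∈B′ , j∉B , b₁ = j , j∈B′ , j∉B , eq , trans (cong (λ X → swap X j i) (sym eq)) (swap-involutive i∈B j∉B)
    where
    sub : swap B i j ⊆ B′
    sub {e} e∈ with swap⁻ e∈
    ... | inj₁ refl = j∈B′
    ... | inj₂ (e∈B , e≢i) with e ∈? B′
    ...   | yes e∈B′ = e∈B′
    ...   | no e∉B′  = ⊥-elim (e≢i (only e e∈B e∉B′))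
    eq : swap B i j ≡ B′
    eq = nested-bases-equal b₁ b′ sub

  -- Whereas `exchange` controls the basis that `i` leaves, this controls the basis that `i` enters.
  -- By induction on `∣ B ─ B′ ∣`: exchanging another element `e` of `B` for one of `B′` moves `B`
  -- closer to `B′` and keeps `i`.
  dual-exchange : ∀ B B′ → IsBasis M B → IsBasis M B′ → ∀ i → i ∈ B → i ∉ B′ →
    ∃[ j ] (j ∈ B′ × j ∉ B × IsBasis M (swap B′ j i))
  dual-exchange B B′ = go ∣ B ─ B′ ∣ B ℕₚ.≤-refl
    where
    go : ∀ m B → ∣ B ─ B′ ∣ ℕ.≤ m → IsBasis M B → IsBasis M B′ → ∀ i → i ∈ B → i ∉ B′ →
      ∃[ j ] (j ∈ B′ × j ∉ B × IsBasis M (swap B′ j i))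
    go m B ≤m b b′ i i∈B i∉B′ with another-difference? B B′ i
    ... | inj₂ only with unique-difference b b′ i∈B i∉B′ only
    ...   | j , j∈B′ , j∉B , _ , eq = j , j∈B′ , j∉B , subst (IsBasis M) (sym eq) b
    go m B ≤m b b′ i i∈B i∉B′ | inj₁ (e , e∈B , e∉B′ , e≢i) with exchange M B B′ b b′ e e∈B e∉B′
    ... | k , k∈B′ , k∉B , b₁ = smaller m (ℕₚ.≤-trans (p⊂q⇒∣p∣<∣q∣ closer) ≤m)
      where
      B₁ : Subset n
      B₁ = swap B e k
      closer : (B₁ ─ B′) ⊂ (B ─ B′)
      closer = sub , e , x∈p∧x∉q⇒x∈p─q e∈B e∉B′ ,
               λ e∈ → swap-out (∈∉⇒≢ e∈B k∉B) (proj₁ (∈─⁻ B₁ B′ e∈))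
        where
        sub : (B₁ ─ B′) ⊆ (B ─ B′)
        sub x∈ with ∈─⁻ B₁ B′ x∈
        ... | x∈B₁ , x∉B′ with swap⁻ x∈B₁
        ...   | inj₁ refl      = ⊥-elim (x∉B′ k∈B′)
        ...   | inj₂ (x∈B , _) = x∈p∧x∉q⇒x∈p─q x∈B x∉B′
      smaller : ∀ m → suc ∣ B₁ ─ B′ ∣ ℕ.≤ m → ∃[ j ] (j ∈ B′ × j ∉ B × IsBasis M (swap B′ j i))
      smaller (suc m) (ℕ.s≤s ≤m) with go m B₁ ≤m b₁ b′ i (swap-old k i∈B (λ i≡e → e≢i (sym i≡e))) i∉B′
      ... | j , j∈B′ , j∉B₁ , basis = j , j∈B′ , j∉B , basis
        where
        -- The only element of `B` missing from `B₁` is `e`, which is not in `B′`.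
        j∉B : j ∉ B
        j∉B j∈B = j∉B₁ (swap-old k j∈B λ j≡e → e∉B′ (subst (_∈ B′) j≡e j∈B′))

module _ (R : RealLine) where
  open RealLine R renaming (_≤_ to _≤ᴿ_)

  -- Ordered abelian group arithmetic

  private
    abelianGroup : AbelianGroup _ _
    abelianGroup = record { isAbelianGroup = isAbelianGroup }

    module G = AbelianGroup abelianGroup
    module Gₚ = AbelianGroupProperties abelianGroup
    module O = IsDecTotalOrder isDecTotalOrder

  open Mult G.commutativeMonoid using (×-homo-+) renaming (_×_ to _·_)
  open CommutativeSemigroupProperties G.commutativeSemigroup using () renaming (interchange to +-interchange)

  -- A solver for identities in an abelian group

  infixl 6 _:+_
  infix  8 :-_

  data Expr (m : ℕ) : Set where
    var  : Fin m → Expr m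
    _:+_ : Expr m → Expr m → Expr m
    :-_  : Expr m → Expr m
    :0   : Expr m

  private
    -- A pair (p , q) at position x stands for p x − q x.
    Coefficients : ℕ → Set
    Coefficients m = Vec (ℕ × ℕ) m

    value : ∀ {m} → Coefficients m → Vec ℝ m → ℝ
    value []             []      = 0ℝ
    value ((p , q) ∷ cs) (x ∷ ρ) = (p · x + q · neg x) + value cs ρ

    zeros : ∀ {m} → Coefficients m
    zeros = Vec.replicate _ (0 , 0)

    unit : ∀ {m} → Fin m → Coefficients m
    unit zero    = (1 , 0) ∷ zeros
    unit (suc i) = (0 , 0) ∷ unit i

    plus : ∀ {m} → Coefficients m → Coefficients m → Coefficients m
    plus = Vec.zipWith λ (p , q) (p′ , q′) → p ℕ.+ p′ , q ℕ.+ q′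

    opposite : ∀ {m} → Coefficients m → Coefficients m
    opposite = Vec.map λ (p , q) → q , p

    -- Removing the common part leaves a unique pair for each integer difference, so equal linear
    -- expressions get identical normal forms.
    cancel : ℕ → ℕ → ℕ × ℕ
    cancel zero    q       = zero , q
    cancel (suc p) zero    = suc p , zero
    cancel (suc p) (suc q) = cancel p q

    reduce : ∀ {m} → Coefficients m → Coefficients m
    reduce = Vec.map λ (p , q) → cancel p q

    coefficients : ∀ {m} → Expr m → Coefficients m
    coefficients (var i)  = unit i
    coefficients (e :+ f) = plus (coefficients e) (coefficients f)
    coefficients (:- e)   = opposite (coefficients e)
    coefficients :0       = zeros

    ⟦_⟧ ⟦_⇓⟧ : ∀ {m} → Expr m → Vec ℝ m → ℝ
    ⟦ var i ⟧  ρ = lookup ρ i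
    ⟦ e :+ f ⟧ ρ = ⟦ e ⟧ ρ + ⟦ f ⟧ ρ
    ⟦ :- e ⟧   ρ = neg (⟦ e ⟧ ρ)
    ⟦ :0 ⟧     ρ = 0ℝ
    ⟦ e ⇓⟧ ρ = value (reduce (coefficients e)) ρ

    value-zeros : ∀ {m} (ρ : Vec ℝ m) → value zeros ρ ≡ 0ℝ
    value-zeros []      = refl
    value-zeros (x ∷ ρ) = trans (cong₂ _+_ (G.identityˡ 0ℝ) (value-zeros ρ)) (G.identityˡ 0ℝ)

    value-unit : ∀ {m} (i : Fin m) ρ → value (unit i) ρ ≡ lookup ρ i
    value-unit zero    (x ∷ ρ) = trans (cong₂ _+_ (trans (G.identityʳ _) (G.identityʳ x)) (value-zeros ρ)) (G.identityʳ x)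
    value-unit (suc i) (x ∷ ρ) = trans (cong₂ _+_ (G.identityˡ 0ℝ) (value-unit i ρ)) (G.identityˡ _)

    value-plus : ∀ {m} (cs ds : Coefficients m) ρ → value (plus cs ds) ρ ≡ value cs ρ + value ds ρ
    value-plus []             []               []      = sym (G.identityˡ 0ℝ)
    value-plus ((p , q) ∷ cs) ((p′ , q′) ∷ ds) (x ∷ ρ) =
      trans (cong₂ _+_ (trans (cong₂ _+_ (×-homo-+ x p p′) (×-homo-+ (neg x) q q′)) (+-interchange _ _ _ _))
                       (value-plus cs ds ρ))
            (+-interchange _ _ _ _)

    neg-multiple : ∀ p x → neg (p · x) ≡ p · neg x
    neg-multiple zero    x = Gₚ.ε⁻¹≈ε
    neg-multiple (suc p) x = trans (sym (Gₚ.⁻¹-∙-comm x (p · x))) (cong (neg x +_) (neg-multiple p x))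

    value-opposite : ∀ {m} (cs : Coefficients m) ρ → value (opposite cs) ρ ≡ neg (value cs ρ)
    value-opposite []             []      = sym Gₚ.ε⁻¹≈ε
    value-opposite ((p , q) ∷ cs) (x ∷ ρ) =
      trans (cong₂ _+_ head (value-opposite cs ρ)) (Gₚ.⁻¹-∙-comm _ _)
      where
      head : q · x + p · neg x ≡ neg (p · x + q · neg x)
      head = trans (G.comm _ _) (trans (cong₂ _+_ (sym (neg-multiple p x))
        (trans (cong (q ·_) (sym (Gₚ.⁻¹-involutive x))) (sym (neg-multiple q (neg x))))) (Gₚ.⁻¹-∙-comm _ _))

    value-cancel : ∀ p q x → let (p′ , q′) = cancel p q in p′ · x + q′ · neg x ≡ p · x + q · neg x
    value-cancel zero    q       x = refl
    value-cancel (suc p) zero    x = refl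
    value-cancel (suc p) (suc q) x = trans (value-cancel p q x)
      (sym (trans (+-interchange x (p · x) (neg x) (q · neg x))
             (trans (cong (_+ (p · x + q · neg x)) (G.inverseʳ x)) (G.identityˡ _))))

    value-reduce : ∀ {m} (cs : Coefficients m) ρ → value (reduce cs) ρ ≡ value cs ρ
    value-reduce []             []      = refl
    value-reduce ((p , q) ∷ cs) (x ∷ ρ) = cong₂ _+_ (value-cancel p q x) (value-reduce cs ρ)

    value-coefficients : ∀ {m} (e : Expr m) ρ → value (coefficients e) ρ ≡ ⟦ e ⟧ ρ
    value-coefficients (var i)  ρ = value-unit i ρ
    value-coefficients (e :+ f) ρ = trans (value-plus (coefficients e) (coefficients f) ρ)
      (cong₂ _+_ (value-coefficients e ρ) (value-coefficients f ρ))
    value-coefficients (:- e)   ρ = trans (value-opposite (coefficients e) ρ) (cong neg (value-coefficients e ρ))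
    value-coefficients :0       ρ = value-zeros ρ

    correct : ∀ {m} (e : Expr m) ρ → ⟦ e ⇓⟧ ρ ≡ ⟦ e ⟧ ρ
    correct e ρ = trans (value-reduce (coefficients e) ρ) (value-coefficients e ρ)

  open Reflection (setoid ℝ) var ⟦_⟧ ⟦_⇓⟧ correct using (solve; _⊜_)

  -- Inequalities

  ≤+≤ : ∀ {a b c d} → a ≤ᴿ b → c ≤ᴿ d → a + c ≤ᴿ b + d
  ≤+≤ {a} {b} {c} {d} a≤b c≤d = O.trans (+-mono c a≤b)
    (O.trans (O.reflexive (G.comm b c)) (O.trans (+-mono b c≤d) (O.reflexive (G.comm d b))))

  -- Linear inequalities: y − x = b − a, so the sign of one is that of the other.
  ≤-by : ∀ {a b x y} → a ≤ᴿ b → y + a ≡ x + b → x ≤ᴿ y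
  ≤-by {a} {b} {x} {y} a≤b eq = O.trans (O.reflexive left)
    (O.trans (+-mono (y + neg b) a≤b) (O.reflexive (solve 2 (λ y b → b :+ (y :+ :- b) ⊜ y) refl y b)))
    where
    left : x ≡ a + (y + neg b)
    left = trans (solve 2 (λ x b → x ⊜ x :+ b :+ :- b) refl x b)
      (trans (cong (_+ neg b) (sym eq)) (solve 3 (λ y a b → y :+ a :+ :- b ⊜ a :+ (y :+ :- b)) refl y a b))

  <-by : ∀ {a b x y} → a < b → y + a ≡ x + b → x < y
  <-by {a} {b} {x} (a≤b , a≢b) eq = ≤-by a≤b eq , λ { refl → a≢b (Gₚ.∙-cancelˡ x a b eq) }

  <+≤ : ∀ {a b c d} → a < b → c ≤ᴿ d → a + c < b + d
  <+≤ (a≤b , a≢b) c≤d = ≤+≤ a≤b c≤d , λ eq → a≢b (O.antisym a≤b (≤-by c≤d eq))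

  <⇒≱ : ∀ {a b} → a < b → ¬ (b ≤ᴿ a)
  <⇒≱ (a≤b , a≢b) b≤a = a≢b (O.antisym a≤b b≤a)

  ≤⊎> : ∀ a b → a ≤ᴿ b ⊎ b < a
  ≤⊎> a b with a O.≤? b
  ... | yes a≤b = inj₁ a≤b
  ... | no a≰b with O.total a b
  ...   | inj₁ a≤b = ⊥-elim (a≰b a≤b)
  ...   | inj₂ b≤a = inj₂ (b≤a , λ { refl → a≰b O.refl })

  below-both : ∀ d x y → ∃[ c ] (d + c ≤ᴿ x × d + c ≤ᴿ y)
  below-both d x y with O.total x y
  ... | inj₁ x≤y = x + neg d , O.reflexive d+[x-d] , O.trans (O.reflexive d+[x-d]) x≤y
    where
    d+[x-d] : d + (x + neg d) ≡ x
    d+[x-d] = solve 2 (λ d x → d :+ (x :+ :- d) ⊜ x) refl d x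
  ... | inj₂ y≤x = y + neg d , O.trans (O.reflexive d+[y-d]) y≤x , O.reflexive d+[y-d]
    where
    d+[y-d] : d + (y + neg d) ≡ y
    d+[y-d] = solve 2 (λ d y → d :+ (y :+ :- d) ⊜ y) refl d y

  -- Optimisation over finite sets

  Minimum : {A : Set} → (A → Set) → (A → ℝ) → Set
  Minimum P g = (∃[ x ] (P x × (∀ y → P y → g x ≤ᴿ g y))) ⊎ (∀ y → ¬ P y)

  -- The recursion step for both `Fin` and `Subset`: when two maps jointly hit every point, the
  -- smaller of the two partial minima is the minimum.
  minimum-cover : ∀ {A B C : Set} (f : A → C) (h : B → C) →
    (∀ c → (∃[ a ] (f a ≡ c)) ⊎ (∃[ b ] (h b ≡ c))) → ∀ {P g} →
    Minimum (P ∘ f) (g ∘ f) → Minimum (P ∘ h) (g ∘ h) → Minimum P g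
  minimum-cover f h cover {P} {g} = combine
    where
    both : ∀ {Q : _ → Set} → (∀ a → Q (f a)) → (∀ b → Q (h b)) → ∀ c → Q c
    both onF onH c with cover c
    ... | inj₁ (a , refl) = onF a
    ... | inj₂ (b , refl) = onH b
    combine : Minimum (P ∘ f) (g ∘ f) → Minimum (P ∘ h) (g ∘ h) → Minimum P g
    combine (inj₂ noF) (inj₂ noH) = inj₂ (both noF noH)
    combine (inj₁ (a , Pa , a-min)) (inj₂ noH) =
      inj₁ (f a , Pa , both a-min (λ b Pb → ⊥-elim (noH b Pb)))
    combine (inj₂ noF) (inj₁ (b , Pb , b-min)) =
      inj₁ (h b , Pb , both (λ a Pa → ⊥-elim (noF a Pa)) b-min)
    combine (inj₁ (a , Pa , a-min)) (inj₁ (b , Pb , b-min)) with O.total (g (f a)) (g (h b))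
    ... | inj₁ a≤b = inj₁ (f a , Pa , both a-min (λ y Py → O.trans a≤b (b-min y Py)))
    ... | inj₂ b≤a = inj₁ (h b , Pb , both (λ y Py → O.trans b≤a (a-min y Py)) b-min)

  minimum-point : ∀ {A : Set} {P : A → Set} {g} a → (∀ b → a ≡ b) → Dec (P a) → Minimum P g
  minimum-point a unique (yes Pa) = inj₁ (a , Pa , λ b _ → O.reflexive (cong _ (unique b)))
  minimum-point {P = P} a unique (no ¬Pa) = inj₂ λ b Pb → ¬Pa (subst P (sym (unique b)) Pb)

  minimum-Fin : ∀ {m} {P : Fin m → Set} → (∀ e → Dec (P e)) → ∀ g → Minimum P g
  minimum-Fin {zero}  P? g = inj₂ λ ()
  minimum-Fin {suc m} P? g = minimum-cover {A = Fin 1} (λ _ → zero) suc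
    (λ { zero → inj₁ (zero , refl) ; (suc e) → inj₂ (e , refl) })
    (minimum-point zero (λ { zero → refl }) (P? zero))
    (minimum-Fin (P? ∘ suc) (g ∘ suc))

  minimum-Subset : ∀ {m} {P : Subset m → Set} → (∀ X → Dec (P X)) → ∀ g → Minimum P g
  minimum-Subset {zero}  P? g = minimum-point [] (λ { [] → refl }) (P? [])
  minimum-Subset {suc m} P? g = minimum-cover (true ∷_) (false ∷_)
    (λ { (true ∷ X) → inj₁ (X , refl) ; (false ∷ X) → inj₂ (X , refl) })
    (minimum-Subset (P? ∘ (true ∷_)) (g ∘ (true ∷_)))
    (minimum-Subset (P? ∘ (false ∷_)) (g ∘ (false ∷_)))

  lower-bound : ∀ {A : Set} {g : A → ℝ} → Minimum (λ _ → ⊤) g → ∃[ c ] (∀ x → c ≤ᴿ g x)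
  lower-bound {g = g} (inj₁ (x , _ , x-min)) = g x , λ y → x-min y tt
  lower-bound (inj₂ none) = 0ℝ , λ x → ⊥-elim (none x tt)

  upper-bound : ∀ {A : Set} {g : A → ℝ} → Minimum (λ _ → ⊤) (neg ∘ g) → ∃[ c ] (∀ x → g x ≤ᴿ c)
  upper-bound {g = g} minimum with lower-bound minimum
  ... | c , bound = neg c , λ x → ≤-by (bound x) (solve 2 (λ c g → :- c :+ c ⊜ g :+ :- g) refl c (g x))

  -- Linear weights

  ∑-cong : ∀ {m} {f g : Fin m → ℝ} → (∀ e → f e ≡ g e) → ∑ R f ≡ ∑ R g
  ∑-cong {zero}  f≗g = refl
  ∑-cong {suc m} f≗g = cong₂ _+_ (f≗g zero) (∑-cong (f≗g ∘ suc))

  ∑-+ : ∀ {m} (f g : Fin m → ℝ) → ∑ R (λ e → f e + g e) ≡ ∑ R f + ∑ R g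
  ∑-+ {zero}  f g = sym (G.identityˡ 0ℝ)
  ∑-+ {suc m} f g = trans (cong (f zero + g zero +_) (∑-+ (f ∘ suc) (g ∘ suc))) (+-interchange _ _ _ _)

  ∑-mono : ∀ {m} {f g : Fin m → ℝ} → (∀ e → f e ≤ᴿ g e) → ∑ R f ≤ᴿ ∑ R g
  ∑-mono {zero}  f≤g = O.refl
  ∑-mono {suc m} f≤g = ≤+≤ (f≤g zero) (∑-mono (f≤g ∘ suc))

  pairSet-cong : ∀ {n} {u w : Fin n → ℝ} → (∀ e → u e ≡ w e) → ∀ X → pairSet R u X ≡ pairSet R w X
  pairSet-cong u≗w X = ∑-cong λ e → cong (λ c → if lookup X e then c else 0ℝ) (u≗w e)

  pairSet-+ : ∀ {n} (u w : Fin n → ℝ) X → pairSet R (λ e → u e + w e) X ≡ pairSet R u X + pairSet R w X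
  pairSet-+ u w X = trans (∑-cong split) (∑-+ (λ e → if lookup X e then u e else 0ℝ) (λ e → if lookup X e then w e else 0ℝ))
    where
    split : ∀ e → (if lookup X e then u e + w e else 0ℝ) ≡
                  (if lookup X e then u e else 0ℝ) + (if lookup X e then w e else 0ℝ)
    split e with lookup X e
    ... | true  = refl
    ... | false = sym (G.identityˡ 0ℝ)

  pairSet-minus : ∀ {n} (u : Fin n → ℝ) {X b} → b ∈ X → pairSet R u (X - b) + u b ≡ pairSet R u X
  pairSet-minus u {_ ∷ X} {zero} here =
    trans (cong (λ Y → 0ℝ + pairSet R (u ∘ suc) Y + u zero) (p─⊥≡p X))
    (solve 2 (λ a x → :0 :+ x :+ a ⊜ a :+ x) refl (u zero) (pairSet R (u ∘ suc) X))
  pairSet-minus u {_ ∷ X} {suc b} (there b∈X) =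
    trans (G.assoc _ _ _) (cong (_ +_) (pairSet-minus (u ∘ suc) b∈X))

  pairSet-add : ∀ {n} (u : Fin n → ℝ) {X j} → j ∉ X → pairSet R u (X ∪ ⁅ j ⁆) ≡ pairSet R u X + u j
  pairSet-add u {true ∷ X}  {zero} j∉X = ⊥-elim (j∉X here)
  pairSet-add u {false ∷ X} {zero} j∉X rewrite ∪-identityʳ X =
    solve 2 (λ a x → a :+ x ⊜ :0 :+ x :+ a) refl (u zero) (pairSet R (u ∘ suc) X)
  pairSet-add u {true ∷ X}  {suc j} j∉X =
    trans (cong (_ +_) (pairSet-add (u ∘ suc) (j∉X ∘ there))) (sym (G.assoc _ _ _))
  pairSet-add u {false ∷ X} {suc j} j∉X =
    trans (cong (_ +_) (pairSet-add (u ∘ suc) (j∉X ∘ there))) (sym (G.assoc _ _ _))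

  pairSet-swap : ∀ {n} (u : Fin n → ℝ) {X b j} → b ∈ X → j ∉ X →
    pairSet R u (swap X b j) + u b ≡ pairSet R u X + u j
  pairSet-swap u {X} {b} {j} b∈X j∉X = begin
    pairSet R u (swap X b j) + u b  ≡⟨ cong (_+ u b) (pairSet-add u (j∉X ∘ p─q⊆p X ⁅ b ⁆)) ⟩
    pairSet R u (X - b) + u j + u b ≡⟨ solve 3 (λ x j b → x :+ j :+ b ⊜ x :+ b :+ j) refl _ (u j) (u b) ⟩
    pairSet R u (X - b) + u b + u j ≡⟨ cong (_+ u j) (pairSet-minus u b∈X) ⟩
    pairSet R u X + u j             ∎
    where open ≡-Reasoning

  ind : ∀ {n} → Subset n → ℝ → Fin n → ℝ
  ind S c e = if lookup S e then c else 0ℝ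

  pairSet-ind : ∀ {n} (S : Subset n) c X → pairSet R (ind S c) X ≡ ∣ X ∩ S ∣ · c
  pairSet-ind []          c []          = refl
  pairSet-ind (true ∷ S)  c (true ∷ X)  = cong (c +_) (pairSet-ind S c X)
  pairSet-ind (false ∷ S) c (true ∷ X)  = trans (G.identityˡ _) (pairSet-ind S c X)
  pairSet-ind (true ∷ S)  c (false ∷ X) = trans (G.identityˡ _) (pairSet-ind S c X)
  pairSet-ind (false ∷ S) c (false ∷ X) = trans (G.identityˡ _) (pairSet-ind S c X)

  pairSet-ind-∈ : ∀ {n} {b : Fin n} c {X} → b ∈ X → pairSet R (ind ⁅ b ⁆ c) X ≡ c
  pairSet-ind-∈ {b = b} c {X} b∈X = trans (pairSet-ind ⁅ b ⁆ c X)
    (trans (cong (λ Y → ∣ Y ∣ · c) X∩b≡b) (trans (cong (_· c) (∣⁅x⁆∣≡1 b)) (G.identityʳ c)))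
    where
    X∩b≡b : X ∩ ⁅ b ⁆ ≡ ⁅ b ⁆
    X∩b≡b = ⊆-antisym (p∩q⊆q X ⁅ b ⁆) λ e∈b → x∈p∩q⁺ (subst (_∈ X) (sym (x∈⁅y⁆⇒x≡y b e∈b)) b∈X , e∈b)

  pairSet-ind-∉ : ∀ {n} {b : Fin n} c {X} → b ∉ X → pairSet R (ind ⁅ b ⁆ c) X ≡ 0ℝ
  pairSet-ind-∉ {n} {b} c {X} b∉X = trans (pairSet-ind ⁅ b ⁆ c X)
    (cong (_· c) (trans (cong ∣_∣ (Empty-unique empty)) (∣⊥∣≡0 n)))
    where
    empty : ¬ (∃[ e ] (e ∈ X ∩ ⁅ b ⁆))
    empty (e , e∈) with x∈p∩q⁻ X ⁅ b ⁆ e∈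
    ... | e∈X , e∈b = b∉X (subst (_∈ X) (x∈⁅y⁆⇒x≡y b e∈b) e∈X)

  -- With `c` nonpositive, further multiples only lower the value, so a larger count is worth at
  -- least one extra `c`.
  multiple-≤ : ∀ {c} → c ≤ᴿ 0ℝ → ∀ {k l} → k ℕ.< l → l · c ≤ᴿ k · c + c
  multiple-≤ {c} c≤0 {zero} {suc l} _ = O.trans (≤+≤ O.refl (nonpositive l)) (O.reflexive (G.comm c 0ℝ))
    where
    nonpositive : ∀ l → l · c ≤ᴿ 0ℝ
    nonpositive zero    = O.refl
    nonpositive (suc l) = O.trans (≤+≤ c≤0 (nonpositive l)) (O.reflexive (G.identityˡ 0ℝ))
  multiple-≤ {c} c≤0 {suc k} {suc l} (ℕ.s≤s k<l) =
    O.trans (≤+≤ O.refl (multiple-≤ c≤0 k<l)) (O.reflexive (sym (G.assoc _ _ _)))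

  -- Weights on the bases of a matroid

  module _ {n : ℕ} (M : Matroid n) (f : Subset n → ℝ) where

    wt : (Fin n → ℝ) → Subset n → ℝ
    wt u X = f X + pairSet R u X

    IsMin : (Fin n → ℝ) → Subset n → Set
    IsMin u X = IsBasis M X × (∀ Y → IsBasis M Y → wt u X ≤ᴿ wt u Y)

    -- The subdivision induced by `f` is matroidal: each of its cells is the set of bases of a
    -- matroid, the initial matroid at `u`.
    InitialMatroids : Set
    InitialMatroids = ∀ u → ∃[ N ] (∀ X → IsMin u X ⇔ IsBasis {n} N X)

    -- No single swap lowers the weight; the terms of `wt` shared by `B` and the swapped basis are
    -- cancelled.
    LocalMin : (Fin n → ℝ) → Subset n → Set
    LocalMin u B = ∀ b j → b ∈ B → j ∉ B → IsBasis M (swap B b j) → f B + u b ≤ᴿ f (swap B b j) + u j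

    Exchangeable : Subset n → Subset n → Fin n → Fin n → Set
    Exchangeable B B′ i j = j ∈ B′ × j ∉ B × IsBasis M (swap B i j) × IsBasis M (swap B′ j i) ×
      f (swap B i j) + f (swap B′ j i) ≤ᴿ f B + f B′

    ValuatedExchange : Set
    ValuatedExchange = ∀ B B′ → IsBasis M B → IsBasis M B′ → ∀ i → i ∈ B → i ∉ B′ →
      ∃[ j ] Exchangeable B B′ i j

    -- Stated without subtraction, in the form that `≤-by` consumes, to pass between inequalities of
    -- total weights and inequalities at the two swapped elements.
    wt-swap : ∀ u {X b j} → b ∈ X → j ∉ X →
      wt u (swap X b j) + (f X + u b) ≡ wt u X + (f (swap X b j) + u j)
    wt-swap u {X} {b} {j} b∈X j∉X = begin
      f Y + pairSet R u Y + (f X + u b)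
        ≡⟨ solve 4 (λ y p x b → y :+ p :+ (x :+ b) ⊜ x :+ y :+ (p :+ b)) refl (f Y) (pairSet R u Y) (f X) (u b) ⟩
      f X + f Y + (pairSet R u Y + u b)
        ≡⟨ cong (f X + f Y +_) (pairSet-swap u b∈X j∉X) ⟩
      f X + f Y + (pairSet R u X + u j)
        ≡⟨ solve 4 (λ x y p j → x :+ y :+ (p :+ j) ⊜ x :+ p :+ (y :+ j)) refl (f X) (f Y) (pairSet R u X) (u j) ⟩
      f X + pairSet R u X + (f Y + u j) ∎
      where
      open ≡-Reasoning
      Y = swap X b j

    wt≤wt-swap⁻ : ∀ u {X b j} → b ∈ X → j ∉ X → wt u X ≤ᴿ wt u (swap X b j) → f X + u b ≤ᴿ f (swap X b j) + u j
    wt≤wt-swap⁻ u b∈X j∉X le = ≤-by le (trans (G.comm _ _) (trans (sym (wt-swap u b∈X j∉X)) (G.comm _ _)))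

    wt-swap≤wt : ∀ u {X b j} → b ∈ X → j ∉ X → f (swap X b j) + u j ≤ᴿ f X + u b → wt u (swap X b j) ≤ᴿ wt u X
    wt-swap≤wt u b∈X j∉X le = ≤-by le (sym (wt-swap u b∈X j∉X))

    wt-swap≤wt⁻ : ∀ u {X b j} → b ∈ X → j ∉ X → wt u (swap X b j) ≤ᴿ wt u X → f (swap X b j) + u j ≤ᴿ f X + u b
    wt-swap≤wt⁻ u b∈X j∉X le = ≤-by le (trans (G.comm _ _) (trans (wt-swap u b∈X j∉X) (G.comm _ _)))

    wt-cong : ∀ {u w} → (∀ e → u e ≡ w e) → ∀ X → wt u X ≡ wt w X
    wt-cong u≗w X = cong (f X +_) (pairSet-cong u≗w X)

    IsMin-cong : ∀ {u w} → (∀ e → u e ≡ w e) → ∀ {X} → IsMin u X → IsMin w X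
    IsMin-cong u≗w (x , min) = x , λ Y y →
      O.trans (O.reflexive (sym (wt-cong u≗w _))) (O.trans (min Y y) (O.reflexive (wt-cong u≗w Y)))

    IsMin-≤ : ∀ {u X Y} → IsMin u X → IsBasis M Y → wt u Y ≤ᴿ wt u X → IsMin u Y
    IsMin-≤ (_ , min) y Y≤X = y , λ Z z → O.trans Y≤X (min Z z)

    wt-shift : ∀ u S c X → wt (λ e → u e + ind S c e) X ≡ wt u X + ∣ X ∩ S ∣ · c
    wt-shift u S c X = trans (cong (f X +_) (trans (pairSet-+ u (ind S c) X) (cong (_ +_) (pairSet-ind S c X))))
      (sym (G.assoc _ _ _))

    wt-bonus-∈ : ∀ u {b} c {X} → b ∈ X → wt (λ e → u e + ind ⁅ b ⁆ c e) X ≡ wt u X + c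
    wt-bonus-∈ u {b} c {X} b∈X = trans (cong (f X +_) (trans (pairSet-+ u (ind ⁅ b ⁆ c) X) (cong (_ +_) (pairSet-ind-∈ c b∈X))))
      (sym (G.assoc _ _ _))

    wt-bonus-∉ : ∀ u {b} c {X} → b ∉ X → wt (λ e → u e + ind ⁅ b ⁆ c e) X ≡ wt u X
    wt-bonus-∉ u {b} c {X} b∉X = cong (f X +_) (trans (pairSet-+ u (ind ⁅ b ⁆ c) X)
      (trans (cong (_ +_) (pairSet-ind-∉ c b∉X)) (G.identityʳ _)))

    abstract
      -- All weights lie between `lo` and `hi`, so a bonus larger than their gap on each element of
      -- `S` ranks sets first by how much of `S` they contain. Every larger `L` works too, which
      -- lets one `L` serve two matroids.
      large-bonus : ∀ (u : Fin n → ℝ) S → ∃[ L₀ ] (∀ L → L₀ ≤ᴿ L → neg L ≤ᴿ 0ℝ × (∀ X Y → ∣ X ∩ S ∣ ℕ.< ∣ Y ∩ S ∣ →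
        wt (λ e → u e + ind S (neg L) e) Y < wt (λ e → u e + ind S (neg L) e) X))
      large-bonus u S with nontrivial | lower-bound {g = wt u} (minimum-Subset (λ _ → yes tt) _)
                             | upper-bound {g = wt u} (minimum-Subset (λ _ → yes tt) _)
      -- The summand `ε` makes the domination strict.
      ... | ε , 0<ε | lo , lo≤ | hi , ≤hi = ε + hi + neg lo , λ L L₀≤L → bonus-sign L L₀≤L , dominates L L₀≤L
        where
        bonus-sign : ∀ L → ε + hi + neg lo ≤ᴿ L → neg L ≤ᴿ 0ℝ
        bonus-sign L L₀≤L = ≤-by (≤+≤ (proj₁ 0<ε) (≤+≤ (O.trans (lo≤ S) (≤hi S)) L₀≤L))
          (solve 4 (λ ε hi lo L → :0 :+ (:0 :+ (lo :+ (ε :+ hi :+ :- lo))) ⊜ :- L :+ (ε :+ (hi :+ L))) refl ε hi lo L)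
        dominates : ∀ L → ε + hi + neg lo ≤ᴿ L → ∀ X Y → ∣ X ∩ S ∣ ℕ.< ∣ Y ∩ S ∣ →
          wt (λ e → u e + ind S (neg L) e) Y < wt (λ e → u e + ind S (neg L) e) X
        dominates L L₀≤L X Y X<Y = subst₂ _<_ (sym (wt-shift u S (neg L) Y)) (sym (wt-shift u S (neg L) X))
          (<-by (<+≤ 0<ε (≤+≤ (≤hi Y) (≤+≤ (lo≤ X) (≤+≤ (multiple-≤ (bonus-sign L L₀≤L) X<Y) L₀≤L))))
            (solve 8 (λ ε hi lo L x y k l →
               x :+ k :+ (:0 :+ (y :+ (lo :+ (l :+ (ε :+ hi :+ :- lo))))) ⊜
               y :+ l :+ (ε :+ (hi :+ (x :+ (k :+ :- L :+ L))))) refl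
               ε hi lo L (wt u X) (wt u Y) (∣ X ∩ S ∣ · neg L) (∣ Y ∩ S ∣ · neg L)))

  -- Local minima are global minima

  module _ {n : ℕ} {M : Matroid n} {f : Subset n → ℝ} (initial : InitialMatroids M f) where

    -- The bonus on `b` is reset to the value at which `B` and `X₀` tie. Both are then minimisers:
    -- bases with `b` compare with `B` as they did under `L`, and bases without `b` are no better
    -- than `X₀`. Exchanging `b` inside the initial matroid gives a minimiser one swap from `B`.
    improving-swap : ∀ {B u b L X₀} → b ∈ B → IsMin M f (λ e → u e + ind ⁅ b ⁆ (neg L) e) B →
      IsBasis M X₀ → b ∉ X₀ → (∀ Y → IsBasis M Y × b ∉ Y → wt M f u X₀ ≤ᴿ wt M f u Y) → wt M f u X₀ < wt M f u B →
      ∃[ j ] (j ∉ B × IsBasis M (swap B b j) × f (swap B b j) + u j < f B + u b)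
    improving-swap {B} {u} {b} {L} {X₀} b∈B (basis , B-min) x₀ b∉X₀ best X₀<B
      with initial (λ e → u e + ind ⁅ b ⁆ (neg (wt M f u B + neg (wt M f u X₀))) e)
    ... | N , spec = improve (exchange N B X₀ (proj₁ (spec B) B-min′) (proj₁ (spec X₀) X₀-min′) b b∈B b∉X₀)
      where
      s : ℝ
      s = wt M f u B + neg (wt M f u X₀)
      u′ : Fin n → ℝ
      u′ e = u e + ind ⁅ b ⁆ (neg s) e
      B≡X₀ : wt M f u′ B ≡ wt M f u X₀
      B≡X₀ = trans (wt-bonus-∈ M f u (neg s) b∈B)
        (solve 2 (λ x y → x :+ :- (x :+ :- y) ⊜ y) refl (wt M f u B) (wt M f u X₀))
      X₀≡X₀ : wt M f u′ X₀ ≡ wt M f u X₀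
      X₀≡X₀ = wt-bonus-∉ M f u (neg s) b∉X₀
      B≤ : ∀ Y → IsBasis M Y → wt M f u′ B ≤ᴿ wt M f u′ Y
      B≤ Y y with b ∈? Y
      ... | no b∉Y = O.trans (O.reflexive B≡X₀) (O.trans (best Y (y , b∉Y)) (O.reflexive (sym (wt-bonus-∉ M f u (neg s) b∉Y))))
      ... | yes b∈Y rewrite wt-bonus-∈ M f u (neg s) b∈B | wt-bonus-∈ M f u (neg s) b∈Y =
        ≤-by (O.trans (O.reflexive (sym (wt-bonus-∈ M f u (neg L) b∈B))) (O.trans (B-min Y y) (O.reflexive (wt-bonus-∈ M f u (neg L) b∈Y))))
          (solve 4 (λ x y s L → y :+ :- s :+ (x :+ :- L) ⊜ x :+ :- s :+ (y :+ :- L)) refl (wt M f u B) (wt M f u Y) s L)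
      B-min′ : IsMin M f u′ B
      B-min′ = basis , B≤
      X₀-min′ : IsMin M f u′ X₀
      X₀-min′ = IsMin-≤ M f B-min′ x₀ (O.reflexive (trans X₀≡X₀ (sym B≡X₀)))
      improve : ∃[ j ] (j ∈ X₀ × j ∉ B × IsBasis N (swap B b j)) →
        ∃[ j ] (j ∉ B × IsBasis M (swap B b j) × f (swap B b j) + u j < f B + u b)
      improve (j , j∈X₀ , j∉B , inN) with proj₂ (spec (swap B b j)) inN
      ... | basis′ , swap-min = j , j∉B , basis′ , <-by (<+≤ X₀<B swap≤X₀)
        (trans (solve 4 (λ fB ub x₀ y → fB :+ ub :+ (x₀ :+ y) ⊜ y :+ (fB :+ ub) :+ x₀) refl
                  (f B) (u b) (wt M f u X₀) (wt M f u (swap B b j)))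
          (trans (cong (_+ wt M f u X₀) (wt-swap M f u b∈B j∉B))
            (solve 4 (λ fS uj x₀ B → B :+ (fS :+ uj) :+ x₀ ⊜ fS :+ uj :+ (B :+ x₀)) refl
                  (f (swap B b j)) (u j) (wt M f u X₀) (wt M f u B))))
        where
        -- The swapped basis avoids `b`, so the bonus does not affect its weight.
        swap≤X₀ : wt M f u (swap B b j) ≤ᴿ wt M f u X₀
        swap≤X₀ = O.trans (O.reflexive (sym (wt-bonus-∉ M f u (neg s) (swap-out (∈∉⇒≢ b∈B j∉B)))))
          (O.trans (swap-min X₀ x₀) (O.reflexive X₀≡X₀))

    -- Among bases containing `b` the bonus is a common constant. Among the others it suffices to
    -- look at a best one, and if that one beat `B`, `improving-swap` would contradict local
    -- minimality.
    remove-bonus : ∀ {B u b L} → b ∈ B → LocalMin M f u B → IsMin M f (λ e → u e + ind ⁅ b ⁆ (neg L) e) B → IsMin M f u B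
    remove-bonus {B} {u} {b} {L} b∈B local B-min@(basis , B≤) = basis , B≤′
      where
      containing : ∀ Y → IsBasis M Y → b ∈ Y → wt M f u B ≤ᴿ wt M f u Y
      containing Y y b∈Y =
        ≤-by (O.trans (O.reflexive (sym (wt-bonus-∈ M f u (neg L) b∈B))) (O.trans (B≤ Y y) (O.reflexive (wt-bonus-∈ M f u (neg L) b∈Y))))
          (solve 3 (λ x y L → y :+ (x :+ :- L) ⊜ x :+ (y :+ :- L)) refl (wt M f u B) (wt M f u Y) L)
      not-improving : ¬ (∃[ j ] (j ∉ B × IsBasis M (swap B b j) × f (swap B b j) + u j < f B + u b))
      not-improving (j , j∉B , basis′ , better) = <⇒≱ better (local b j b∈B j∉B basis′)
      avoid? : ∀ X → Dec (IsBasis M X × b ∉ X)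
      avoid? X = T? (isBasis M X) ×-dec ¬? (b ∈? X)
      avoiding : Minimum (λ X → IsBasis M X × b ∉ X) (wt M f u) → ∀ Y → IsBasis M Y × b ∉ Y → wt M f u B ≤ᴿ wt M f u Y
      avoiding (inj₂ none) Y y = ⊥-elim (none Y y)
      avoiding (inj₁ (X₀ , (x₀ , b∉X₀) , best)) Y y with ≤⊎> (wt M f u B) (wt M f u X₀)
      ... | inj₁ B≤X₀ = O.trans B≤X₀ (best Y y)
      ... | inj₂ X₀<B = ⊥-elim (not-improving (improving-swap {u = u} {b} {L} b∈B B-min x₀ b∉X₀ best X₀<B))
      B≤′ : ∀ Y → IsBasis M Y → wt M f u B ≤ᴿ wt M f u Y
      B≤′ Y y with b ∈? Y
      ... | yes b∈Y = containing Y y b∈Y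
      ... | no b∉Y  = avoiding (minimum-Subset avoid? (wt M f u)) Y (y , b∉Y)

    -- With a large bonus on all of `B`, the basis `B` is a minimiser; the bonuses are then removed
    -- one element at a time by `remove-bonus`.
    local-min⇒min : ∀ {B u} → IsBasis M B → LocalMin M f u B → IsMin M f u B
    local-min⇒min {B} {u} basis local with large-bonus M f u B
    ... | L , large with large L O.refl
    ...   | negL≤0 , dominates = go ∣ B ∣ B ℕₚ.≤-refl id (basis , B≤)
      where
      with-bonus : Subset n → Fin n → ℝ
      with-bonus U e = u e + ind U (neg L) e
      B≤ : ∀ Y → IsBasis M Y → wt M f (with-bonus B) B ≤ᴿ wt M f (with-bonus B) Y
      B≤ Y y with ∣ Y ∩ B ∣ ℕ.<? ∣ B ∩ B ∣
      ... | yes less = proj₁ (dominates Y B less)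
      ... | no ¬less = O.reflexive (cong (wt M f (with-bonus B)) (nested-bases-equal M basis y B⊆Y))
        where
        B⊆Y : B ⊆ Y
        B⊆Y e∈B = p∩q⊆p Y B (p⊆q∧∣q∣≤∣p∣⇒q⊆p (p∩q⊆q Y B)
          (subst (ℕ._≤ ∣ Y ∩ B ∣) (cong ∣_∣ (∩-idem B)) (ℕₚ.≮⇒≥ ¬less)) e∈B)
      -- A bonus inside `B` can only favour the element that a swap takes out, so local minimality
      -- survives at every stage.
      local-bonus : ∀ U → U ⊆ B → LocalMin M f (with-bonus U) B
      local-bonus U U⊆B b j b∈B j∉B basis′ =
        ≤-by (≤+≤ (local b j b∈B j∉B basis′) nonpositive)
          (trans (cong (λ z → f (swap B b j) + (u j + z) + (f B + u b + ind U (neg L) b)) (if-∉ (j∉B ∘ U⊆B)))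
            (solve 5 (λ s j B b i → s :+ (j :+ :0) :+ (B :+ b :+ i) ⊜ B :+ (b :+ i) :+ (s :+ j :+ :0)) refl
              (f (swap B b j)) (u j) (f B) (u b) (ind U (neg L) b)))
        where
        nonpositive : ind U (neg L) b ≤ᴿ 0ℝ
        nonpositive with lookup U b
        ... | true  = negL≤0
        ... | false = O.refl
      move : ∀ U b → b ∈ U → ∀ e → with-bonus U e ≡ with-bonus (U - b) e + ind ⁅ b ⁆ (neg L) e
      move U b b∈U e with e ≟ b
      ... | yes refl rewrite []=⇒lookup b∈U | []=⇒lookup (x∈⁅x⁆ b) | lookup-∉ {B = U - b} (λ b∈ → proj₂ (∈-minus⁻ U b∈) refl) =
        solve 2 (λ u c → u :+ c ⊜ u :+ :0 :+ c) refl (u b) (neg L)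
      ... | no e≢b rewrite lookup-∉ (x≢y⇒x∉⁅y⁆ e≢b) = trans (cong (u e +_) same) (sym (G.identityʳ _))
        where
        same : ind U (neg L) e ≡ ind (U - b) (neg L) e
        same with e ∈? U
        ... | yes e∈U = trans (if-∈ e∈U) (sym (if-∈ (x∈p∧x≢y⇒x∈p-y e∈U e≢b)))
        ... | no e∉U  = trans (if-∉ e∉U) (sym (if-∉ (e∉U ∘ proj₁ ∘ ∈-minus⁻ U)))
      go : ∀ m U → ∣ U ∣ ℕ.≤ m → U ⊆ B → IsMin M f (with-bonus U) B → IsMin M f u B
      go m U ≤m U⊆B B-min with nonempty? U
      ... | no empty = IsMin-cong M f (λ e → trans (cong (u e +_) (if-∉ (λ e∈U → empty (e , e∈U)))) (G.identityʳ (u e))) B-min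
      go zero U ≤m U⊆B B-min | yes (b , b∈U) = ⊥-elim (ℕₚ.<⇒≱ (x∈p⇒∣p-x∣<∣p∣ b∈U) (ℕₚ.≤-trans ≤m ℕ.z≤n))
      go (suc m) U ≤m U⊆B B-min | yes (b , b∈U) =
        go m (U - b) (ℕ.s≤s⁻¹ (ℕₚ.≤-trans (x∈p⇒∣p-x∣<∣p∣ b∈U) ≤m)) (U⊆B ∘ p─q⊆p U ⁅ b ⁆)
          (remove-bonus {u = with-bonus (U - b)} {L = L} (U⊆B b∈U) (local-bonus (U - b) (U⊆B ∘ p─q⊆p U ⁅ b ⁆))
            (IsMin-cong M f (move U b b∈U) B-min))

    -- The valuated exchange axiom

    private
      -- Turns a failure of the exchange axiom at `B`, `B′`, `i` into a failure at `B`, `B″`, `i`,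
      -- where `B″` is closer to `B`.
      module Perturbation {B B′ i k} (b : IsBasis M B) (b′ : IsBasis M B′) (i∈B : i ∈ B) (i∉B′ : i ∉ B′)
        (k∈B : k ∈ B) (k∉B′ : k ∉ B′) (k≢i : k ≢ i) (stuck : ∀ j → ¬ Exchangeable M f B B′ i j) where

        -- The weight v below is built in the order i, B′ ∖ B, k, B ∩ B′, everything else:
        -- each value is chosen relative to the preceding ones.

        ε : ℝ
        ε = proj₁ nontrivial

        v-i : ℝ
        -- Normalises `f B + v-i` to zero. On bases `swap B i j`, `v-new` makes
        -- `f (swap B i j) + v-new j` zero as well, so that these bases tie with `B`.
        v-i = neg (f B)

        abstract
          v-new : Fin n → ℝ
          v-new j = if isBasis M (swap B i j) then neg (f (swap B i j))
                    -- If `swap B i j` is no basis, the value is free; this one puts `B′` below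
                    -- `swap B′ j i` by exactly `ε`.
                    else f (swap B′ j i) + neg (f B) + neg (f B′) + neg ε

          v-new-basis : ∀ {j} → IsBasis M (swap B i j) → v-new j ≡ neg (f (swap B i j))
          v-new-basis = if-yes (T? _)

          -- When `swap B i j` is a basis, this is the negated exchange inequality `stuck`,
          -- rewritten through the tie with `B`; otherwise it is built into `v-new`.
          i-excluded : ∀ {j} → j ∈ B′ → j ∉ B → IsBasis M (swap B′ j i) → f B′ + v-new j < f (swap B′ j i) + v-i
          i-excluded {j} j∈B′ j∉B basis′ = cases (T? (isBasis M (swap B i j)))
            where
            cases : Dec (IsBasis M (swap B i j)) → f B′ + v-new j < f (swap B′ j i) + v-i
            cases (no ¬basis) = <-by (proj₂ nontrivial)
              (trans (solve 4 (λ s B B′ ε → s :+ :- B :+ :0 ⊜ B′ :+ (s :+ :- B :+ :- B′ :+ :- ε) :+ ε) refl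
                (f (swap B′ j i)) (f B) (f B′) ε)
                (cong (λ c → f B′ + c + ε) (sym (if-no (T? _) ¬basis))))
            cases (yes basis) with ≤⊎> (f (swap B i j) + f (swap B′ j i)) (f B + f B′)
            ... | inj₁ le = ⊥-elim (stuck j (j∈B′ , j∉B , basis , basis′ , le))
            ... | inj₂ gt = <-by gt
              (trans (solve 4 (λ s t B B′ → t :+ :- B :+ (B :+ B′) ⊜ B′ :+ :- s :+ (s :+ t)) refl
                (f (swap B i j)) (f (swap B′ j i)) (f B) (f B′))
                (cong (λ c → f B′ + c + (f (swap B i j) + f (swap B′ j i))) (sym (v-new-basis basis))))

        Candidate : Fin n → Set
        Candidate j = j ∈ B′ × j ∉ B × IsBasis M (swap B′ j k)

        slack : Fin n → ℝ
        slack j = f (swap B′ j k) + neg (v-new j)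

        abstract
          -- Dual exchange provides a candidate. As the weight of `k` decreases, the candidate of
          -- least slack is the first whose swap ties with `B′`.
          tight : ∃[ l ] (Candidate l × (∀ j → Candidate j → slack l ≤ᴿ slack j))
          tight = found (minimum-Fin (λ j → (j ∈? B′) ×-dec (¬? (j ∈? B) ×-dec T? (isBasis M (swap B′ j k)))) slack)
            where
            found : Minimum Candidate slack → ∃[ l ] (Candidate l × (∀ j → Candidate j → slack l ≤ᴿ slack j))
            found (inj₁ l)    = l
            found (inj₂ none) with dual-exchange M B B′ b b′ k k∈B k∉B′
            ... | j , candidate = ⊥-elim (none j candidate)

        l : Fin n
        l = proj₁ tight

        l∈B′ : l ∈ B′
        l∈B′ = proj₁ (proj₁ (proj₂ tight))

        l∉B : l ∉ B
        l∉B = proj₁ (proj₂ (proj₁ (proj₂ tight)))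

        B″ : Subset n
        B″ = swap B′ l k

        b″ : IsBasis M B″
        b″ = proj₂ (proj₂ (proj₁ (proj₂ tight)))

        v-k : ℝ
        -- The value at which `B″` ties with `B′`; by the choice of `l`, no other candidate swap
        -- beats `B′`.
        v-k = f B′ + neg (slack l)

        abstract
          -- Elements of `B ∩ B′` are made so cheap that trading one for `i` or `k` never pays.
          low : ∀ j → ∃[ c ] (f B′ + c ≤ᴿ f (swap B′ j i) + v-i × f B′ + c ≤ᴿ f (swap B′ j k) + v-k)
          low j = below-both (f B′) (f (swap B′ j i) + v-i) (f (swap B′ j k) + v-k)

        v-B′ : Fin n → ℝ
        v-B′ j = if lookup B j then proj₁ (low j) else v-new j

        abstract
          -- The remaining elements outside `B′` are made so expensive that bringing one in never
          -- pays.
          high : ∀ e → ∃[ c ] (∀ j → f B′ + v-B′ j + neg (f (swap B′ j e)) ≤ᴿ c)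
          high e = upper-bound (minimum-Fin (λ _ → yes tt) _)

          v : Fin n → ℝ
          v e = if lookup B′ e then v-B′ e else
                if does (e ≟ i) then v-i else
                if does (e ≟ k) then v-k else proj₁ (high e)

          v-on-B′ : ∀ {j} → j ∈ B′ → v j ≡ v-B′ j
          v-on-B′ = if-∈

          v-on-new : ∀ {j} → j ∈ B′ → j ∉ B → v j ≡ v-new j
          v-on-new j∈B′ j∉B = trans (v-on-B′ j∈B′) (if-∉ j∉B)

          v-on-i : v i ≡ v-i
          v-on-i = trans (if-∉ i∉B′) (if-yes (i ≟ i) refl)

          v-on-k : v k ≡ v-k
          v-on-k = trans (if-∉ k∉B′) (trans (if-no (k ≟ i) k≢i) (if-yes (k ≟ k) refl))

          v-on-other : ∀ {e} → e ∉ B′ → e ≢ i → e ≢ k → v e ≡ proj₁ (high e)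
          v-on-other {e} e∉B′ e≢i e≢k = trans (if-∉ e∉B′) (trans (if-no (e ≟ i) e≢i) (if-no (e ≟ k) e≢k))

        abstract
          bound-i : ∀ {j} → j ∈ B′ → IsBasis M (swap B′ j i) → f B′ + v-B′ j ≤ᴿ f (swap B′ j i) + v-i
          bound-i {j} j∈B′ basis = cases (j ∈? B)
            where
            cases : Dec (j ∈ B) → f B′ + v-B′ j ≤ᴿ f (swap B′ j i) + v-i
            cases (yes j∈B) = subst (λ c → f B′ + c ≤ᴿ f (swap B′ j i) + v-i) (sym (if-∈ j∈B)) (proj₁ (proj₂ (low j)))
            cases (no j∉B)  = subst (λ c → f B′ + c ≤ᴿ f (swap B′ j i) + v-i) (sym (if-∉ j∉B)) (proj₁ (i-excluded j∈B′ j∉B basis))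

          bound-k : ∀ {j} → j ∈ B′ → IsBasis M (swap B′ j k) → f B′ + v-B′ j ≤ᴿ f (swap B′ j k) + v-k
          bound-k {j} j∈B′ basis = cases (j ∈? B)
            where
            cases : Dec (j ∈ B) → f B′ + v-B′ j ≤ᴿ f (swap B′ j k) + v-k
            cases (yes j∈B) = subst (λ c → f B′ + c ≤ᴿ f (swap B′ j k) + v-k) (sym (if-∈ j∈B)) (proj₂ (proj₂ (low j)))
            cases (no j∉B)  = subst (λ c → f B′ + c ≤ᴿ f (swap B′ j k) + v-k) (sym (if-∉ j∉B))
              (≤-by (proj₂ (proj₂ tight) j (j∈B′ , j∉B , basis))
                (solve 4 (λ s B′ l v → s :+ (B′ :+ :- l) :+ l ⊜ B′ :+ v :+ (s :+ :- v)) refl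
                  (f (swap B′ j k)) (f B′) (slack l) (v-new j)))

          local : LocalMin M f v B′
          local j e j∈B′ e∉B′ basis =
            subst (λ c → f B′ + c ≤ᴿ f (swap B′ j e) + v e) (sym (v-on-B′ j∈B′)) (bound e∉B′ basis (e ≟ i) (e ≟ k))
            where
            bound : ∀ {e} → e ∉ B′ → IsBasis M (swap B′ j e) → Dec (e ≡ i) → Dec (e ≡ k) → f B′ + v-B′ j ≤ᴿ f (swap B′ j e) + v e
            bound e∉B′ basis (yes refl) _ =
              subst (λ c → f B′ + v-B′ j ≤ᴿ f (swap B′ j i) + c) (sym v-on-i) (bound-i j∈B′ basis)
            bound e∉B′ basis (no _) (yes refl) =
              subst (λ c → f B′ + v-B′ j ≤ᴿ f (swap B′ j k) + c) (sym v-on-k) (bound-k j∈B′ basis)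
            bound {e} e∉B′ basis (no e≢i) (no e≢k) =
              subst (λ c → f B′ + v-B′ j ≤ᴿ f (swap B′ j e) + c) (sym (v-on-other e∉B′ e≢i e≢k))
                (≤-by (proj₂ (high e) j)
                  (solve 3 (λ s x c → s :+ c :+ (x :+ :- s) ⊜ x :+ c) refl
                    (f (swap B′ j e)) (f B′ + v-B′ j) (proj₁ (high e))))

        abstract
          B′-min : IsMin M f v B′
          B′-min = local-min⇒min b′ local

        abstract
          B″-min : IsMin M f v B″
          B″-min = IsMin-≤ M f B′-min b″ (wt-swap≤wt M f v l∈B′ k∉B′ (O.reflexive
            (trans (cong (f B″ +_) v-on-k)
              (trans (solve 3 (λ s B′ vl → s :+ (B′ :+ :- (s :+ :- vl)) ⊜ B′ :+ vl) refl (f B″) (f B′) (v-new l))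
                (cong (f B′ +_) (sym (v-on-new l∈B′ l∉B)))))))

        i∉B″ : i ∉ B″
        i∉B″ i∈B″ with swap⁻ i∈B″
        ... | inj₁ i≡k        = k≢i (sym i≡k)
        ... | inj₂ (i∈B′ , _) = i∉B′ i∈B′

        closer : (B ─ B″) ⊂ (B ─ B′)
        closer = sub , k , x∈p∧x∉q⇒x∈p─q k∈B k∉B′ , λ k∈ → proj₂ (∈─⁻ B B″ k∈) (swap-new B′ l k)
          where
          sub : (B ─ B″) ⊆ (B ─ B′)
          sub e∈ with ∈─⁻ B B″ e∈
          ... | e∈B , e∉B″ = x∈p∧x∉q⇒x∈p─q e∈B λ e∈B′ → e∉B″ (swap-old k e∈B′ (∈∉⇒≢ e∈B l∉B))

        -- Since `swap B i j` ties with `B`, the exchange inequality makes `X` no heavier than `B″`,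
        -- hence minimal. Dual exchange in the initial matroid then brings `i` into `B′` at no cost,
        -- against `i-excluded`.
        impossible : ¬ (∃[ j ] Exchangeable M f B B″ i j)
        impossible (j , j∈B″ , j∉B , b₁ , b₂ , le) = contradiction (initial v)
          where
          X : Subset n
          X = swap B″ j i
          j∈B′ : j ∈ B′
          j∈B′ with swap⁻ j∈B″
          ... | inj₁ refl       = ⊥-elim (j∉B k∈B)
          ... | inj₂ (j∈B′ , _) = j∈B′
          X-min : IsMin M f v X
          X-min = IsMin-≤ M f B″-min b₂ (wt-swap≤wt M f v j∈B″ i∉B″
            (subst₂ (λ c d → f X + c ≤ᴿ f B″ + d) (sym v-on-i) (sym (trans (v-on-new j∈B′ j∉B) (v-new-basis b₁)))
              (≤-by le (solve 4 (λ x b b″ s → b″ :+ :- s :+ (s :+ x) ⊜ x :+ :- b :+ (b :+ b″)) refl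
                (f X) (f B) (f B″) (f (swap B i j))))))
          -- Both `l` and `j` lie outside `B`, so `X` still contains all of `B ∩ B′`.
          outside-B : ∀ {j′} → j′ ∈ B′ → j′ ∉ X → j′ ∉ B
          outside-B {j′} j′∈B′ j′∉X j′∈B = j′∉X (swap-old i (swap-old k j′∈B′ (∈∉⇒≢ j′∈B l∉B)) (∈∉⇒≢ j′∈B j∉B))
          contradiction : ¬ (∃[ N ] (∀ Y → IsMin M f v Y ⇔ IsBasis {n} N Y))
          contradiction (N , spec)
            with dual-exchange N X B′ (proj₁ (spec X) X-min) (proj₁ (spec B′) B′-min) i (swap-new B″ j i) i∉B′
          ... | j′ , j′∈B′ , j′∉X , inN with proj₂ (spec (swap B′ j′ i)) inN
          ...   | basis , min = <⇒≱ (i-excluded j′∈B′ j′∉B basis)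
              (subst₂ (λ c d → f (swap B′ j′ i) + c ≤ᴿ f B′ + d) v-on-i (v-on-new j′∈B′ j′∉B)
                (wt-swap≤wt⁻ M f v j′∈B′ i∉B′ (min B′ b′)))
            where
            j′∉B : j′ ∉ B
            j′∉B = outside-B j′∈B′ j′∉X

    exchangeable? : ∀ B B′ i j → Dec (Exchangeable M f B B′ i j)
    exchangeable? B B′ i j = (j ∈? B′) ×-dec (¬? (j ∈? B) ×-dec (T? _ ×-dec (T? _ ×-dec (_ O.≤? _))))

    abstract
      -- Exchangeability is decidable, so a failure may be assumed. The induction on `∣ B ─ B′ ∣`
      -- keeps `B` fixed and supplies the exchange at `B″` that `Perturbation` refutes.
      valuated-exchange : ValuatedExchange M f
      valuated-exchange B B′ = go (suc ∣ B ─ B′ ∣) B′ ℕₚ.≤-refl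
        where
        go : ∀ m B′ → ∣ B ─ B′ ∣ ℕ.< m → IsBasis M B → IsBasis M B′ → ∀ i → i ∈ B → i ∉ B′ →
          ∃[ j ] Exchangeable M f B B′ i j
        go (suc m) B′ <m b b′ i i∈B i∉B′ = decide (any? (exchangeable? B B′ i))
          where
          decide : Dec (∃[ j ] Exchangeable M f B B′ i j) → ∃[ j ] Exchangeable M f B B′ i j
          decide (yes found) = found
          decide (no none) with another-difference? B B′ i
          ... | inj₂ only with unique-difference M b b′ i∈B i∉B′ only
          ...   | j , j∈B′ , j∉B , eq , eq′ = j , j∈B′ , j∉B ,
              subst (IsBasis M) (sym eq) b′ , subst (IsBasis M) (sym eq′) b ,
              O.reflexive (trans (cong₂ _+_ (cong f eq) (cong f eq′)) (G.comm (f B′) (f B)))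
          decide (no none) | inj₁ (k , k∈B , k∉B′ , k≢i) =
            ⊥-elim (P.impossible (go m P.B″ (ℕₚ.<-≤-trans (p⊂q⇒∣p∣<∣q∣ P.closer) (ℕ.s≤s⁻¹ <m)) b P.b″ i i∈B P.i∉B″))
            where
            module P = Perturbation b b′ i∈B i∉B′ k∈B k∉B′ k≢i (λ j e → none (j , e))

  -- Contractions

  module _ {n : ℕ} (S : Subset n) where

    splice : Subset n → Subset n → Subset n
    splice B C = (B ∩ S) ∪ (C ─ S)

    splice⁺ˡ : ∀ {B C e} → e ∈ B → e ∈ S → e ∈ splice B C
    splice⁺ˡ {C = C} e∈B e∈S = p⊆p∪q (C ─ S) (x∈p∩q⁺ (e∈B , e∈S))

    splice⁺ʳ : ∀ {B C e} → e ∈ C → e ∉ S → e ∈ splice B C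
    splice⁺ʳ {B} e∈C e∉S = q⊆p∪q (B ∩ S) _ (x∈p∧x∉q⇒x∈p─q e∈C e∉S)

    splice⁻ : ∀ {B C e} → e ∈ splice B C → (e ∈ B × e ∈ S) ⊎ (e ∈ C × e ∉ S)
    splice⁻ {B} {C} e∈ with x∈p∪q⁻ (B ∩ S) (C ─ S) e∈
    ... | inj₁ e∈∩ = inj₁ (x∈p∩q⁻ B S e∈∩)
    ... | inj₂ e∈─ = inj₂ (∈─⁻ C S e∈─)

    ∩∪-∩ : ∀ B {A} → A ⊆ ∁ S → ((B ∩ S) ∪ A) ∩ S ≡ B ∩ S
    ∩∪-∩ B {A} A⊆∁S = ⊆-antisym to (λ e∈ → x∈p∩q⁺ (p⊆p∪q A e∈ , p∩q⊆q B S e∈))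
      where
      to : ((B ∩ S) ∪ A) ∩ S ⊆ B ∩ S
      to e∈ with x∈p∩q⁻ ((B ∩ S) ∪ A) S e∈
      ... | e∈∪ , e∈S with x∈p∪q⁻ (B ∩ S) A e∈∪
      ...   | inj₁ e∈∩ = e∈∩
      ...   | inj₂ e∈A = ⊥-elim (x∈∁p⇒x∉p (A⊆∁S e∈A) e∈S)

    ∩∪-─ : ∀ B {A} → A ⊆ ∁ S → ((B ∩ S) ∪ A) ─ S ≡ A
    ∩∪-─ B {A} A⊆∁S = ⊆-antisym to (λ e∈A → x∈p∧x∉q⇒x∈p─q (q⊆p∪q (B ∩ S) A e∈A) (x∈∁p⇒x∉p (A⊆∁S e∈A)))
      where
      to : ((B ∩ S) ∪ A) ─ S ⊆ A
      to e∈ with ∈─⁻ ((B ∩ S) ∪ A) S e∈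
      ... | e∈∪ , e∉S with x∈p∪q⁻ (B ∩ S) A e∈∪
      ...   | inj₁ e∈∩ = ⊥-elim (e∉S (p∩q⊆q B S e∈∩))
      ...   | inj₂ e∈A = e∈A

    ─⊆∁ : ∀ C → C ─ S ⊆ ∁ S
    ─⊆∁ C e∈ = x∉p⇒x∈∁p (proj₂ (∈─⁻ C S e∈))

    splice-∩ : ∀ B C → splice B C ∩ S ≡ B ∩ S
    splice-∩ B C = ∩∪-∩ B (─⊆∁ C)

    splice-─ : ∀ B C → splice B C ─ S ≡ C ─ S
    splice-─ B C = ∩∪-─ B (─⊆∁ C)

    splice-idem : ∀ B → splice B B ≡ B
    splice-idem B = ⊆-antisym to from
      where
      to : splice B B ⊆ B
      to e∈ with splice⁻ {B} {B} e∈
      ... | inj₁ (e∈B , _) = e∈B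
      ... | inj₂ (e∈B , _) = e∈B
      from : B ⊆ splice B B
      from {e} e∈B with e ∈? S
      ... | yes e∈S = splice⁺ˡ {B} {B} e∈B e∈S
      ... | no e∉S  = splice⁺ʳ {B} {B} e∈B e∉S

    splice-splice : ∀ B C → splice (splice B C) (splice C B) ≡ B
    splice-splice B C = trans (cong₂ _∪_ (splice-∩ B C) (splice-─ C B)) (splice-idem B)

    swap-∩ : ∀ {B i j} → j ∈ S → swap B i j ∩ S ≡ swap (B ∩ S) i j
    swap-∩ {B} {i} {j} j∈S = ⊆-antisym to from
      where
      to : swap B i j ∩ S ⊆ swap (B ∩ S) i j
      to e∈ with x∈p∩q⁻ (swap B i j) S e∈
      ... | e∈swap , e∈S with swap⁻ e∈swap
      ...   | inj₁ refl        = swap-new (B ∩ S) i j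
      ...   | inj₂ (e∈B , e≢i) = swap-old j (x∈p∩q⁺ (e∈B , e∈S)) e≢i
      from : swap (B ∩ S) i j ⊆ swap B i j ∩ S
      from e∈ with swap⁻ e∈
      ... | inj₁ refl = x∈p∩q⁺ (swap-new B i j , j∈S)
      ... | inj₂ (e∈∩ , e≢i) with x∈p∩q⁻ B S e∈∩
      ...   | e∈B , e∈S = x∈p∩q⁺ (swap-old j e∈B e≢i , e∈S)

    swap-─ : ∀ {B i j} → i ∈ S → j ∈ S → swap B i j ─ S ≡ B ─ S
    swap-─ {B} {i} {j} i∈S j∈S = ⊆-antisym to from
      where
      to : swap B i j ─ S ⊆ B ─ S
      to e∈ with ∈─⁻ (swap B i j) S e∈
      ... | e∈swap , e∉S with swap⁻ e∈swap
      ...   | inj₁ refl      = ⊥-elim (e∉S j∈S)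
      ...   | inj₂ (e∈B , _) = x∈p∧x∉q⇒x∈p─q e∈B e∉S
      from : B ─ S ⊆ swap B i j ─ S
      from e∈ with ∈─⁻ B S e∈
      ... | e∈B , e∉S = x∈p∧x∉q⇒x∈p─q (swap-old j e∈B λ { refl → e∉S i∈S }) e∉S

  MaxOn : ∀ {n} → Matroid n → Subset n → Subset n → Set
  MaxOn M S B = IsBasis M B × (∀ B′ → IsBasis M B′ → ∣ B′ ∩ S ∣ ℕ.≤ ∣ B ∩ S ∣)

  module _ {n : ℕ} (M : Matroid n) {S : Subset n} where

    MaxOn-∩ : ∀ {B C} → MaxOn M S B → IsBasis M C → C ∩ S ≡ B ∩ S → MaxOn M S C
    MaxOn-∩ (_ , B-max) c eq = c , λ X x → subst (λ Y → ∣ X ∩ S ∣ ℕ.≤ ∣ Y ∣) (sym eq) (B-max X x)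

    -- If `j` were outside `S`, the swap would enlarge the intersection with `S` by `i`.
    swap-within : ∀ {C i j} → MaxOn M S C → i ∈ S → i ∉ C → IsBasis M (swap C j i) → j ∈ S
    swap-within {C} {i} {j} (_ , C-max) i∈S i∉C basis with j ∈? S
    ... | yes j∈S = j∈S
    ... | no j∉S  = ⊥-elim (ℕₚ.<⇒≱ (p⊂q⇒∣p∣<∣q∣ larger) (C-max (swap C j i) basis))
      where
      sub : C ∩ S ⊆ swap C j i ∩ S
      sub e∈ with x∈p∩q⁻ C S e∈
      ... | e∈C , e∈S = x∈p∩q⁺ (swap-old i e∈C (∈∉⇒≢ e∈S j∉S) , e∈S)
      larger : (C ∩ S) ⊂ (swap C j i ∩ S)
      larger = sub , i , x∈p∩q⁺ (swap-new C j i , i∈S) , λ i∈ → i∉C (p∩q⊆p C S i∈)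

  module _ {n : ℕ} {M : Matroid n} {f : Subset n → ℝ} (ex : ValuatedExchange M f) (S : Subset n) where

    SpliceBound : Subset n → Subset n → Set
    SpliceBound B C = IsBasis M (splice S B C) × IsBasis M (splice S C B) ×
      f (splice S B C) + f (splice S C B) ≤ᴿ f B + f C

    private
      equal-on-S : ∀ {B C} → IsBasis M B → IsBasis M C → B ∩ S ≡ C ∩ S → SpliceBound B C
      equal-on-S {B} {C} b c eq = subst (IsBasis M) (sym BC≡C) c , subst (IsBasis M) (sym CB≡B) b ,
        O.reflexive (trans (cong₂ _+_ (cong f BC≡C) (cong f CB≡B)) (G.comm (f C) (f B)))
        where
        BC≡C : splice S B C ≡ C
        BC≡C = trans (cong (_∪ (C ─ S)) eq) (splice-idem S C)
        CB≡B : splice S C B ≡ B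
        CB≡B = trans (cong (_∪ (B ─ S)) (sym eq)) (splice-idem S B)

      -- One step of `B` towards `C` inside `S`. The bound for `B₁` and `C` is added to the exchange
      -- inequality for `B` and `D`, and the terms of `B₁` and `D` cancel.
      module Step {B C i j} (B-max : MaxOn M S B) (i∈B : i ∈ B) (i∈S : i ∈ S) (i∉C : i ∉ C)
        (j∈C : j ∈ C) (j∉B : j ∉ B) (b₁ : IsBasis M (swap B i j)) (j∈S : j ∈ S) where

        B₁ : Subset n
        B₁ = swap B i j

        B₁-max : MaxOn M S B₁
        B₁-max = b₁ , λ X x → ℕₚ.≤-trans (proj₂ B-max X x)
          (subst (λ Y → ∣ B ∩ S ∣ ℕ.≤ ∣ Y ∣) (sym (swap-∩ S {B} {i} j∈S)) (∣p∣≤∣swap∣ (B ∩ S) i (j∉B ∘ p∩q⊆p B S)))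

        i∉B₁ : i ∉ B₁
        i∉B₁ = swap-out (∈∉⇒≢ i∈B j∉B)

        closer : ((B₁ ∩ S) ─ C) ⊂ ((B ∩ S) ─ C)
        closer = sub , i , x∈p∧x∉q⇒x∈p─q (x∈p∩q⁺ (i∈B , i∈S)) i∉C ,
          λ i∈ → i∉B₁ (p∩q⊆p B₁ S (proj₁ (∈─⁻ (B₁ ∩ S) C i∈)))
          where
          sub : ((B₁ ∩ S) ─ C) ⊆ ((B ∩ S) ─ C)
          sub e∈ with ∈─⁻ (B₁ ∩ S) C e∈
          ... | e∈∩ , e∉C with x∈p∩q⁻ B₁ S e∈∩
          ...   | e∈B₁ , e∈S with swap⁻ e∈B₁
          ...     | inj₁ refl      = ⊥-elim (e∉C j∈C)
          ...     | inj₂ (e∈B , _) = x∈p∧x∉q⇒x∈p─q (x∈p∩q⁺ (e∈B , e∈S)) e∉C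

        D : Subset n
        D = splice S B₁ C

        i∉D : i ∉ D
        i∉D i∈D with splice⁻ S {B₁} {C} i∈D
        ... | inj₁ (i∈B₁ , _) = i∉B₁ i∈B₁
        ... | inj₂ (i∈C , _)  = i∉C i∈C

        swap-D : swap D j i ≡ splice S B C
        swap-D = ⊆-antisym to from
          where
          to : swap D j i ⊆ splice S B C
          to e∈ with swap⁻ e∈
          ... | inj₁ refl = splice⁺ˡ S {B} {C} i∈B i∈S
          ... | inj₂ (e∈D , e≢j) with splice⁻ S {B₁} {C} e∈D
          ...   | inj₂ (e∈C , e∉S) = splice⁺ʳ S {B} {C} e∈C e∉S
          ...   | inj₁ (e∈B₁ , e∈S) with swap⁻ e∈B₁
          ...     | inj₁ e≡j       = ⊥-elim (e≢j e≡j)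
          ...     | inj₂ (e∈B , _) = splice⁺ˡ S {B} {C} e∈B e∈S
          from : splice S B C ⊆ swap D j i
          from {e} e∈ with e ≟ i
          ... | yes refl = swap-new D j i
          ... | no e≢i with splice⁻ S {B} {C} e∈
          ...   | inj₁ (e∈B , e∈S) = swap-old i (splice⁺ˡ S {B₁} {C} (swap-old j e∈B e≢i) e∈S) (∈∉⇒≢ e∈B j∉B)
          ...   | inj₂ (e∈C , e∉S) = swap-old i (splice⁺ʳ S {B₁} {C} e∈C e∉S) λ { refl → e∉S j∈S }

        -- Maximality of `D` on `S` forces `j′` into `S`, where `D` agrees with `B₁`, and `j` is the
        -- only element of `B₁` outside `B`.
        only-j : ∀ {j′} → MaxOn M S D → Exchangeable M f B D i j′ → j′ ≡ j
        only-j {j′} D-max (j′∈D , j′∉B , _ , basis , _) with splice⁻ S {B₁} {C} j′∈D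
        ... | inj₂ (_ , j′∉S) = ⊥-elim (j′∉S (swap-within M D-max i∈S i∉D basis))
        ... | inj₁ (j′∈B₁ , _) with swap⁻ j′∈B₁
        ...   | inj₁ j′≡j       = j′≡j
        ...   | inj₂ (j′∈B , _) = ⊥-elim (j′∉B j′∈B)

        bound : SpliceBound B₁ C → SpliceBound B C
        bound (d , cb₁ , le₁) = combine (ex B D (proj₁ B-max) d i i∈B i∉D)
          where
          CB₁≡CB : splice S C B₁ ≡ splice S C B
          CB₁≡CB = cong ((C ∩ S) ∪_) (swap-─ S {B} i∈S j∈S)
          D-max : MaxOn M S D
          D-max = MaxOn-∩ M B₁-max d (splice-∩ S B₁ C)
          combine : ∃[ j′ ] Exchangeable M f B D i j′ → SpliceBound B C
          combine (j′ , e) with only-j D-max e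
          combine (j′ , _ , _ , _ , basis , le) | refl =
            subst (IsBasis M) swap-D basis , subst (IsBasis M) CB₁≡CB cb₁ ,
            subst₂ (λ X Y → f X + f Y ≤ᴿ f B + f C) swap-D CB₁≡CB
              (≤-by (≤+≤ le₁ le)
                (solve 6 (λ B C D CB B₁ BC → B :+ C :+ (D :+ CB :+ (B₁ :+ BC)) ⊜ BC :+ CB :+ (B₁ :+ C :+ (B :+ D))) refl
                  (f B) (f C) (f D) (f (splice S C B₁)) (f B₁) (f (swap D j i))))

    abstract
      -- By induction on the part of `B ∩ S` outside `C`. When it is empty, maximality gives
      -- `B ∩ S ≡ C ∩ S`, and splicing merely exchanges the two bases.
      splice-≤ : ∀ {B C} → MaxOn M S B → MaxOn M S C → SpliceBound B C
      splice-≤ {B} {C} B-max C-max = go (suc ∣ (B ∩ S) ─ C ∣) B ℕₚ.≤-refl B-max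
        where
        go : ∀ m B → ∣ (B ∩ S) ─ C ∣ ℕ.< m → MaxOn M S B → SpliceBound B C
        go (suc m) B <m B-max = decide (any? λ e → (e ∈? B) ×-dec ((e ∈? S) ×-dec ¬? (e ∈? C)))
          where
          decide : Dec (∃[ e ] (e ∈ B × e ∈ S × e ∉ C)) → SpliceBound B C
          decide (no none) = equal-on-S (proj₁ B-max) (proj₁ C-max)
            (⊆-antisym sub (p⊆q∧∣q∣≤∣p∣⇒q⊆p sub (proj₂ B-max C (proj₁ C-max))))
            where
            sub : B ∩ S ⊆ C ∩ S
            sub {e} e∈ with x∈p∩q⁻ B S e∈ | e ∈? C
            ... | _   , e∈S | yes e∈C = x∈p∩q⁺ (e∈C , e∈S)
            ... | e∈B , e∈S | no e∉C  = ⊥-elim (none (e , e∈B , e∈S , e∉C))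
          decide (yes (i , i∈B , i∈S , i∉C)) = step (ex B C (proj₁ B-max) (proj₁ C-max) i i∈B i∉C)
            where
            step : ∃[ j ] Exchangeable M f B C i j → SpliceBound B C
            step (j , j∈C , j∉B , b₁ , c₁ , _) =
              P.bound (go m P.B₁ (ℕₚ.<-≤-trans (p⊂q⇒∣p∣<∣q∣ P.closer) (ℕ.s≤s⁻¹ <m)) P.B₁-max)
              where
              module P = Step B-max i∈B i∈S i∉C j∈C j∉B b₁ (swap-within M C-max i∈S i∉C c₁)

      splice-MaxOn : ∀ {B C} → MaxOn M S B → MaxOn M S C → MaxOn M S (splice S B C)
      splice-MaxOn {B} {C} B-max C-max = MaxOn-∩ M B-max (proj₁ (splice-≤ B-max C-max)) (splice-∩ S B C)

      -- Splicing the two splices restores `B` and `C`, so the inequality also holds in reverse.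
      -- This equality is what makes `f` split into a part on `S` and a part off `S`.
      splice-≡ : ∀ {B C} → MaxOn M S B → MaxOn M S C → f (splice S B C) + f (splice S C B) ≡ f B + f C
      splice-≡ {B} {C} B-max C-max = O.antisym (proj₂ (proj₂ (splice-≤ B-max C-max)))
        (subst₂ (λ X Y → f X + f Y ≤ᴿ f (splice S B C) + f (splice S C B)) (splice-splice S B C) (splice-splice S C B)
          (proj₂ (proj₂ (splice-≤ (splice-MaxOn B-max C-max) (splice-MaxOn C-max B-max)))))

  -- Tropical linear spaces

  ⊕-justˡ⁻ : ∀ {a c} t → just c ≡ _⊕_ R (just a) t → ∃[ b ] (t ≡ just b × c ≡ a + b)
  ⊕-justˡ⁻ (just b) eq = b , refl , just-injective eq

  ⊕-justʳ-≤⁻ : ∀ t {a c} → _≤𝕋_ R (_⊕_ R t (just a)) (just c) → ∃[ b ] (t ≡ just b × b + a ≤ᴿ c)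
  ⊕-justʳ-≤⁻ (just b) (fin≤fin le) = b , refl , le

  module _ {n : ℕ} (M : Matroid n) (f : Subset n → ℝ) where

    extend-basis : ∀ {B} → IsBasis M B → extend R M f B ≡ just (f B)
    extend-basis = if-yes (T? _)

    finite⇒basis : ∀ {B} → Finite R (extend R M f B) → IsBasis M B
    finite⇒basis {B} (_ , eq) with isBasis M B
    ... | true = tt

    basis⇒finite : ∀ {B} → IsBasis M B → Finite R (extend R M f B)
    basis⇒finite b = _ , extend-basis b

    InBS⇒MaxOn : ∀ {S B} → InBS R (extend R M f) S B → MaxOn M S B
    InBS⇒MaxOn (fin , max) = finite⇒basis fin , λ X x → max X (basis⇒finite x)

    MaxOn⇒InBS : ∀ {S B} → MaxOn M S B → InBS R (extend R M f) S B
    MaxOn⇒InBS (b , max) = basis⇒finite b , λ X fin → max X (finite⇒basis fin)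

    extend-exchange : ValuatedExchange M f → IsValuatedMatroid R (extend R M f)
    extend-exchange ex = (M , λ B → finite⇒basis , basis⇒finite) , swaps
      where
      swaps : ∀ B B′ → Finite R (extend R M f B) → Finite R (extend R M f B′) → ∀ i → i ∈ B → i ∉ B′ →
        ∃[ j ] (j ∈ B′ × j ∉ B × _≤𝕋_ R (_⊕_ R (extend R M f (swap B i j)) (extend R M f (swap B′ j i)))
                                        (_⊕_ R (extend R M f B) (extend R M f B′)))
      swaps B B′ fin fin′ i i∈B i∉B′ with ex B B′ (finite⇒basis fin) (finite⇒basis fin′) i i∈B i∉B′
      ... | j , j∈B′ , j∉B , b₁ , b₂ , le = j , j∈B′ , j∉B ,
        subst₂ (_≤𝕋_ R) (sym (cong₂ (_⊕_ R) (extend-basis b₁) (extend-basis b₂)))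
                        (sym (cong₂ (_⊕_ R) (extend-basis (finite⇒basis fin)) (extend-basis (finite⇒basis fin′))))
          (fin≤fin le)

  -- The coordinates in S of a boundary point u are ∞; −u is approximated by the finite weight
  -- that is −L on S.
  direction : ∀ {n} → Subset n → (Fin n → ℝ) → ℝ → Fin n → ℝ
  direction S u L e = neg (u e) + ind S (neg L) e

  direction-∉ : ∀ {n} S (u : Fin n → ℝ) L {e} → e ∉ S → direction S u L e ≡ neg (u e)
  direction-∉ S u L {e} e∉S = trans (cong (neg (u e) +_) (if-∉ e∉S)) (G.identityʳ _)

  module _ {n : ℕ} {M : Matroid n} {f : Subset n → ℝ} (ex : ValuatedExchange M f) (S : Subset n) (u : Fin n → ℝ) (L : ℝ)
    (dominates : ∀ X Y → ∣ X ∩ S ∣ ℕ.< ∣ Y ∩ S ∣ → wt M f (direction S u L) Y < wt M f (direction S u L) X) where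

    private
      v : Fin n → ℝ
      v = direction S u L

    min⇒MaxOn : ∀ {X} → IsMin M f v X → MaxOn M S X
    min⇒MaxOn {X} (x , min) = x , λ Y y → ℕₚ.≮⇒≥ λ X<Y → <⇒≱ (dominates X Y X<Y) (min Y y)

    -- No element outside `S` is a loop of the initial matroid at `v`. The two implications below
    -- relate this to the circuit condition of `InTrop`.
    Covered : Set
    Covered = ∀ e → e ∉ S → ∃[ X ] (IsMin M f v X × e ∈ X)

    module _ {X} (X-min : IsMin M f v X) {ν} (contraction : IsContraction R (extend R M f) S ν) (trop : InTrop R ν S u) where

      private
        X-max : MaxOn M S X
        X-max = min⇒MaxOn X-min

        ρ : Subset n → ℝ
        ρ = proj₁ (proj₂ contraction)

        decompose : ∀ {B} → MaxOn M S B → ∃[ a ] (ν (B ─ S) ≡ just a × f B ≡ ρ (B ∩ S) + a)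
        decompose {B} B-max = ⊕-justˡ⁻ (ν (B ─ S))
          (trans (sym (extend-basis M f (proj₁ B-max))) (proj₂ (proj₂ contraction) B (MaxOn⇒InBS M f B-max)))

        module _ {e} (e∉S : e ∉ S) (e∉X : e ∉ X) where

          T′ : Subset n
          T′ = (X ─ S) ∪ ⁅ e ⁆

          T′⁻ : ∀ {x} → x ∈ T′ → (x ∈ X × x ∉ S) ⊎ x ≡ e
          T′⁻ x∈ with x∈p∪q⁻ (X ─ S) ⁅ e ⁆ x∈
          ... | inj₁ x∈─ = inj₁ (∈─⁻ X S x∈─)
          ... | inj₂ x∈e = inj₂ (x∈⁅y⁆⇒x≡y e x∈e)

          T′-old : ∀ {x} → x ∈ X → x ∉ S → x ∈ T′
          T′-old x∈X x∉S = p⊆p∪q ⁅ e ⁆ (x∈p∧x∉q⇒x∈p─q x∈X x∉S)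

          e∈T′ : e ∈ T′
          e∈T′ = q⊆p∪q (X ─ S) ⁅ e ⁆ (x∈⁅x⁆ e)

          T′⊆∁S : T′ ⊆ ∁ S
          T′⊆∁S x∈ with T′⁻ x∈
          ... | inj₁ (_ , x∉S) = x∉p⇒x∈∁p x∉S
          ... | inj₂ refl      = x∉p⇒x∈∁p e∉S

          T′-e : T′ - e ≡ X ─ S
          T′-e = ⊆-antisym to (λ x∈ → x∈p∧x≢y⇒x∈p-y (p⊆p∪q ⁅ e ⁆ x∈) (∈∉⇒≢ (p─q⊆p X S x∈) e∉X))
            where
            to : T′ - e ⊆ X ─ S
            to x∈ with ∈-minus⁻ T′ x∈
            ... | x∈T′ , x≢e with T′⁻ x∈T′
            ...   | inj₁ (x∈X , x∉S) = x∈p∧x∉q⇒x∈p─q x∈X x∉S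
            ...   | inj₂ x≡e         = ⊥-elim (x≢e x≡e)

          val : Fin n → 𝕋 R
          val l = _⊕_ R (ν (T′ - l)) (just (u l))

          a : ℝ
          a = proj₁ (decompose X-max)

          val-e : val e ≡ just (a + u e)
          val-e = cong (λ t → _⊕_ R t (just (u e))) (trans (cong ν T′-e) (proj₁ (proj₂ (decompose X-max))))

          -- Of the two positions attaining the minimum on `T′`, at least one differs from `e`.
          other-minimum : ∃[ l ] (l ∈ T′ × l ≢ e × _≤𝕋_ R (val l) (just (a + u e)))
          other-minimum with trop T′ T′⊆∁S (e , e∈T′ , _ , val-e)
          ... | i , j , i∈T′ , j∈T′ , i≢j , same , min with i ≟ e
          ...   | no i≢e   = i , i∈T′ , i≢e , subst (_≤𝕋_ R (val i)) val-e (min e e∈T′)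
          ...   | yes refl = j , j∈T′ , (λ j≡e → i≢j (sym j≡e)) , subst₂ (_≤𝕋_ R) same val-e (min e e∈T′)

          module _ {l} (l∈T′ : l ∈ T′) (l≢e : l ≢ e) {B} (B-max : MaxOn M S B) (T′-l : T′ - l ≡ B ─ S) where

            l∈X×l∉S : l ∈ X × l ∉ S
            l∈X×l∉S with T′⁻ l∈T′
            ... | inj₁ both = both
            ... | inj₂ l≡e  = ⊥-elim (l≢e l≡e)

            splice-swap : splice S X B ≡ swap X l e
            splice-swap = ⊆-antisym to from
              where
              to : splice S X B ⊆ swap X l e
              to {x} x∈ with splice⁻ S {X} {B} x∈
              ... | inj₁ (x∈X , x∈S) = swap-old e x∈X (∈∉⇒≢ x∈S (proj₂ l∈X×l∉S))
              ... | inj₂ (x∈B , x∉S) with ∈-minus⁻ T′ (subst (x ∈_) (sym T′-l) (x∈p∧x∉q⇒x∈p─q x∈B x∉S))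
              ...   | x∈T′ , x≢l with T′⁻ x∈T′
              ...     | inj₁ (x∈X , _) = swap-old e x∈X x≢l
              ...     | inj₂ refl      = swap-new X l e
              outside : ∀ {x} → x ∈ T′ → x ≢ l → x ∈ splice S X B
              outside {x} x∈T′ x≢l = q⊆p∪q (X ∩ S) (B ─ S) (subst (x ∈_) T′-l (x∈p∧x≢y⇒x∈p-y x∈T′ x≢l))
              from : swap X l e ⊆ splice S X B
              from {x} x∈ with swap⁻ x∈
              ... | inj₁ refl = outside e∈T′ (λ e≡l → l≢e (sym e≡l))
              ... | inj₂ (x∈X , x≢l) with x ∈? S
              ...   | yes x∈S = splice⁺ˡ S {X} {B} x∈X x∈S
              ...   | no x∉S  = outside (T′-old x∈X x∉S) x≢l

            -- The set `T′ - l` is the outer part of some maximal `B`, and splicing replaces the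
            -- inner part of `B` by that of `X`. Both weights then share `ρ (X ∩ S)`, and the sign
            -- in `v` turns the comparison at `l` and `e` into one of `X` with its swap.
            swap-min : ∀ {a′} → ν (T′ - l) ≡ just a′ → a′ + u l ≤ᴿ a + u e → IsMin M f v (swap X l e)
            swap-min {a′} ν-l le = IsMin-≤ M f X-min (subst (IsBasis M) splice-swap (proj₁ Y-max))
              (wt-swap≤wt M f v (proj₁ l∈X×l∉S) e∉X
                (subst₂ _≤ᴿ_
                  (cong₂ _+_ f-swap (sym (direction-∉ S u L e∉S)))
                  (cong₂ _+_ (sym (proj₂ (proj₂ (decompose X-max)))) (sym (direction-∉ S u L (proj₂ l∈X×l∉S))))
                  (≤-by le (solve 5 (λ r a a′ l e → r :+ a :+ :- l :+ (a′ :+ l) ⊜ r :+ a′ :+ :- e :+ (a :+ e)) refl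
                    (ρ (X ∩ S)) a a′ (u l) (u e)))))
              where
              Y-max : MaxOn M S (splice S X B)
              Y-max = splice-MaxOn {M = M} ex S X-max B-max
              f-swap : ρ (X ∩ S) + a′ ≡ f (swap X l e)
              f-swap = trans (cong₂ _+_ (cong ρ (sym (splice-∩ S X B))) (just-injective
                (trans (sym ν-l) (trans (cong ν (trans T′-l (sym (splice-─ S X B)))) (proj₁ (proj₂ (decompose Y-max)))))))
                (trans (sym (proj₂ (proj₂ (decompose Y-max)))) (cong f splice-swap))

          exchange-in : ∃[ Y ] (IsMin M f v Y × e ∈ Y)
          exchange-in with other-minimum
          ... | l , l∈T′ , l≢e , le with ⊕-justʳ-≤⁻ (ν (T′ - l)) le
          ...   | a′ , ν-l , le′ with proj₁ (proj₁ contraction (T′ - l) (T′⊆∁S ∘ proj₁ ∘ ∈-minus⁻ T′)) (a′ , ν-l)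
          ...     | B , B-max , T′-l =
            swap X l e , swap-min l∈T′ l≢e (InBS⇒MaxOn M f B-max) T′-l ν-l le′ , swap-new X l e

      -- If the minimiser `X` misses `e`, the circuit condition on `(X ─ S) ∪ ⁅ e ⁆` yields an
      -- element `l` that `e` can replace at no cost.
      trop⇒covered : Covered
      trop⇒covered e e∉S with e ∈? X
      ... | yes e∈X = X , X-min , e∈X
      ... | no e∉X  = exchange-in e∉S e∉X

    module _ {B₀} (B₀-max : MaxOn M S B₀) where

      -- The usual representative of the contraction: `A` is completed by the fixed set `B₀ ∩ S`, a
      -- basis of the restriction to `S`.
      contract : Subset n → 𝕋 R
      contract A = extend R M f ((B₀ ∩ S) ∪ A)

      contract-MaxOn : ∀ {A} → A ⊆ ∁ S → IsBasis M ((B₀ ∩ S) ∪ A) → MaxOn M S ((B₀ ∩ S) ∪ A)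
      contract-MaxOn A⊆∁S b = MaxOn-∩ M B₀-max b (∩∪-∩ S B₀ A⊆∁S)

      contract-isContraction : IsContraction R (extend R M f) S contract
      -- The factor on `S` is read off from `splice-≡` for `B` and `B₀`; subtracting `f B₀` corrects
      -- for the base point.
      contract-isContraction = supports , (λ Z → f (Z ∪ (B₀ ─ S)) + neg (f B₀)) , factor
        where
        supports : ∀ A → A ⊆ ∁ S → Finite R (contract A) ⇔ (∃[ B ] (InBS R (extend R M f) S B × A ≡ B ─ S))
        supports A A⊆∁S = to , from
          where
          to : Finite R (contract A) → ∃[ B ] (InBS R (extend R M f) S B × A ≡ B ─ S)
          to fin = (B₀ ∩ S) ∪ A , MaxOn⇒InBS M f (contract-MaxOn A⊆∁S (finite⇒basis M f fin)) , sym (∩∪-─ S B₀ A⊆∁S)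
          from : ∃[ B ] (InBS R (extend R M f) S B × A ≡ B ─ S) → Finite R (contract A)
          from (B , B-max , refl) = basis⇒finite M f (proj₁ (splice-≤ {M = M} ex S B₀-max (InBS⇒MaxOn M f B-max)))
        factor : ∀ B → InBS R (extend R M f) S B →
          extend R M f B ≡ _⊕_ R (just (f ((B ∩ S) ∪ (B₀ ─ S)) + neg (f B₀))) (contract (B ─ S))
        factor B inBS = trans (extend-basis M f (proj₁ B-max))
          (trans (cong just eq) (cong (_⊕_ R (just _)) (sym (extend-basis M f (proj₁ (splice-≤ {M = M} ex S B₀-max B-max))))))
          where
          B-max : MaxOn M S B
          B-max = InBS⇒MaxOn M f inBS
          eq : f B ≡ f (splice S B B₀) + neg (f B₀) + f (splice S B₀ B)
          eq = trans (solve 2 (λ b b₀ → b ⊜ b :+ b₀ :+ :- b₀) refl (f B) (f B₀))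
            (trans (cong (_+ neg (f B₀)) (sym (splice-≡ {M = M} ex S B-max B₀-max)))
              (solve 3 (λ x y b₀ → x :+ y :+ :- b₀ ⊜ x :+ :- b₀ :+ y) refl (f (splice S B B₀)) (f (splice S B₀ B)) (f B₀)))

      module _ (covered : Covered) (T′ : Subset n) (T′⊆∁S : T′ ⊆ ∁ S) where

        private
          val : Fin n → 𝕋 R
          val i = _⊕_ R (contract (T′ - i)) (just (u i))

          completed : Fin n → Subset n
          completed i = (B₀ ∩ S) ∪ (T′ - i)

          Candidate : Fin n → Set
          Candidate i = i ∈ T′ × IsBasis M (completed i)

          score : Fin n → ℝ
          score i = f (completed i) + u i

          val-basis : ∀ {i} → IsBasis M (completed i) → val i ≡ just (score i)
          val-basis {i} b = cong (λ t → _⊕_ R t (just (u i))) (extend-basis M f b)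

          completed⁻ : ∀ {i x} → x ∈ completed i → (x ∈ B₀ × x ∈ S) ⊎ (x ∈ T′ × x ≢ i)
          completed⁻ {i} x∈ with x∈p∪q⁻ (B₀ ∩ S) (T′ - i) x∈
          ... | inj₁ x∈∩ = inj₁ (x∈p∩q⁻ B₀ S x∈∩)
          ... | inj₂ x∈- = inj₂ (∈-minus⁻ T′ x∈-)

          completed-S : ∀ {i x} → x ∈ B₀ → x ∈ S → x ∈ completed i
          completed-S {i} x∈B₀ x∈S = p⊆p∪q (T′ - i) (x∈p∩q⁺ (x∈B₀ , x∈S))

          completed-T : ∀ {i x} → x ∈ T′ → x ≢ i → x ∈ completed i
          completed-T {i} x∈T′ x≢i = q⊆p∪q (B₀ ∩ S) (T′ - i) (x∈p∧x≢y⇒x∈p-y x∈T′ x≢i)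

          off-S : ∀ {x} → x ∈ T′ → x ∉ S
          off-S x∈T′ = x∈∁p⇒x∉p (T′⊆∁S x∈T′)

          swap-completed : ∀ {i j} → i ∈ T′ → j ∈ T′ → i ≢ j → swap (completed i) j i ≡ completed j
          swap-completed {i} {j} i∈T′ j∈T′ i≢j = ⊆-antisym to from
            where
            to : swap (completed i) j i ⊆ completed j
            to x∈ with swap⁻ x∈
            ... | inj₁ refl = completed-T i∈T′ i≢j
            ... | inj₂ (x∈c , x≢j) with completed⁻ x∈c
            ...   | inj₁ (x∈B₀ , x∈S) = completed-S x∈B₀ x∈S
            ...   | inj₂ (x∈T′ , _)   = completed-T x∈T′ x≢j
            from : completed j ⊆ swap (completed i) j i
            from {x} x∈ with x ≟ i
            ... | yes refl = swap-new (completed i) j i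
            ... | no x≢i with completed⁻ x∈
            ...   | inj₁ (x∈B₀ , x∈S) = swap-old i (completed-S x∈B₀ x∈S) (∈∉⇒≢ x∈S (off-S j∈T′))
            ...   | inj₂ (x∈T′ , x≢j) = swap-old i (completed-T x∈T′ x≢i) x≢j

          -- A minimiser `X` containing `i` is exchanged with `completed i`. Maximality of `X` on
          -- `S` forces `j` into `T′`, and adding the minimality of `X` against `swap X i j` leaves
          -- the comparison of scores.
          second : ∀ {i} → Candidate i → ∃[ j ] (Candidate j × i ≢ j × score j ≤ᴿ score i)
          second {i} (i∈T′ , b) = use (covered i (off-S i∈T′))
            where
            i∉completed : i ∉ completed i
            i∉completed i∈ with completed⁻ i∈
            ... | inj₁ (_ , i∈S) = off-S i∈T′ i∈S
            ... | inj₂ (_ , i≢i) = i≢i refl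
            use : ∃[ X ] (IsMin M f v X × i ∈ X) → ∃[ j ] (Candidate j × i ≢ j × score j ≤ᴿ score i)
            use (X , X-min , i∈X) = finish (ex X (completed i) (proj₁ X-min) b i i∈X i∉completed)
              where
              finish : ∃[ j ] Exchangeable M f X (completed i) i j → ∃[ j ] (Candidate j × i ≢ j × score j ≤ᴿ score i)
              finish (j , j∈c , j∉X , b₁ , b₂ , le) with completed⁻ j∈c
              ... | inj₁ (_ , j∈S) = ⊥-elim (off-S i∈T′ (swap-within M (min⇒MaxOn X-min) j∈S j∉X b₁))
              ... | inj₂ (j∈T′ , j≢i) = j , (j∈T′ , subst (IsBasis M) eq b₂) , i≢j ,
                subst (λ Y → f Y + u j ≤ᴿ score i) eq
                  (≤-by (≤+≤ le (subst₂ (λ c d → f X + c ≤ᴿ f (swap X i j) + d)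
                                  (direction-∉ S u L (off-S i∈T′)) (direction-∉ S u L (off-S j∈T′))
                                  (wt≤wt-swap⁻ M f v i∈X j∉X (proj₂ X-min _ b₁))))
                    (solve 6 (λ c i s t x j → c :+ i :+ (s :+ t :+ (x :+ :- i)) ⊜ t :+ j :+ (x :+ c :+ (s :+ :- j))) refl
                      (f (completed i)) (u i) (f (swap X i j)) (f (swap (completed i) j i)) (f X) (u j)))
                where
                i≢j : i ≢ j
                i≢j i≡j = j≢i (sym i≡j)
                eq : swap (completed i) j i ≡ completed j
                eq = swap-completed i∈T′ j∈T′ i≢j

          val-≤ : ∀ {i} → (∀ l → Candidate l → score i ≤ᴿ score l) → IsBasis M (completed i) →
            ∀ l → l ∈ T′ → _≤𝕋_ R (val i) (val l)
          val-≤ {i} i-min b l l∈T′ = cases (T? (isBasis M (completed l)))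
            where
            cases : Dec (IsBasis M (completed l)) → _≤𝕋_ R (val i) (val l)
            cases (yes b′) = subst₂ (_≤𝕋_ R) (sym (val-basis b)) (sym (val-basis b′)) (fin≤fin (i-min l (l∈T′ , b′)))
            cases (no ¬b′) = subst (_≤𝕋_ R (val i))
              (sym (cong (λ t → _⊕_ R t (just (u l))) (if-no (T? _) ¬b′))) (val i ≤∞)

        -- Applied to a candidate of least score, `second` gives another one of the same score.
        covered⇒circuit : ∃[ l ] (l ∈ T′ × Finite R (val l)) →
          ∃[ i ] ∃[ j ] (i ∈ T′ × j ∈ T′ × i ≢ j × val i ≡ val j × (∀ l → l ∈ T′ → _≤𝕋_ R (val i) (val l)))
        covered⇒circuit (l , l∈T′ , _ , val-l) =
          choose (minimum-Fin (λ i → (i ∈? T′) ×-dec T? (isBasis M (completed i))) score)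
          where
          finiteˡ : ∀ t {c d} → _⊕_ R t (just c) ≡ just d → Finite R t
          finiteˡ (just b) _ = b , refl
          choose : Minimum Candidate score →
            ∃[ i ] ∃[ j ] (i ∈ T′ × j ∈ T′ × i ≢ j × val i ≡ val j × (∀ l → l ∈ T′ → _≤𝕋_ R (val i) (val l)))
          choose (inj₂ none) = ⊥-elim (none l (l∈T′ , finite⇒basis M f (finiteˡ (contract (T′ - l)) val-l)))
          choose (inj₁ (i , (i∈T′ , b) , i-min)) with second (i∈T′ , b)
          ... | j , (j∈T′ , b′) , i≢j , le = i , j , i∈T′ , j∈T′ , i≢j ,
            trans (val-basis b) (trans (cong just (O.antisym (i-min j (j∈T′ , b′)) le)) (sym (val-basis b′))) ,
            val-≤ i-min b

      covered⇒trop : Covered → InTrop R contract S u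
      covered⇒trop = covered⇒circuit

  -- Flags and products

  -- A loop `e` of `N j` is a one-element circuit, hence a union of circuits of `N i`; a circuit of
  -- `N i` inside `⁅ e ⁆` keeps `e` out of every basis of `N i`.
  flag-nonloop : ∀ {n k} {N : Fin k → Matroid n} → IsFlag N → ∀ {i j} → i <ᶠ j → ∀ {e X} →
    IsBasis (N i) X → e ∈ X → ∃[ Y ] (IsBasis (N j) Y × e ∈ Y)
  flag-nonloop {n} {N = N} flag {i} {j} i<j {e} {X} x e∈X
    with anySubset? (λ Y → T? (isBasis (N j) Y) ×-dec (e ∈? Y))
  ... | yes found = found
  ... | no loop   = ⊥-elim (dependent-in-basis (flag i j i<j ⁅ e ⁆ (dependent , subsets) e (x∈⁅x⁆ e)))
    where
    dependent : ¬ Independent (N j) ⁅ e ⁆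
    dependent (Y , y , e⊆Y) = loop (Y , y , e⊆Y (x∈⁅x⁆ e))
    subsets : ∀ D → D ⊂ ⁅ e ⁆ → Independent (N j) D
    subsets D (D⊆e , z , z∈e , z∉D) with nonempty (N j)
    ... | Y , y = Y , y , λ {d} d∈D → ⊥-elim (z∉D (subst (_∈ D) (trans (x∈⁅y⁆⇒x≡y e (D⊆e d∈D)) (sym (x∈⁅y⁆⇒x≡y e z∈e))) d∈D))
    dependent-in-basis : ¬ (∃[ D ] (Circuit (N i) D × e ∈ D × D ⊆ ⁅ e ⁆))
    dependent-in-basis (D , (¬independent , _) , _ , D⊆e) =
      ¬independent (X , x , λ {d} d∈D → subst (_∈ X) (sym (x∈⁅y⁆⇒x≡y e (D⊆e d∈D))) e∈X)

  ∑-cancel : ∀ {m} {g h : Fin m → ℝ} i → (∀ l → l ≢ i → g l ≡ h l) → ∑ R g ≤ᴿ ∑ R h → g i ≤ᴿ h i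
  ∑-cancel {suc m} {g} {h} zero same le =
    ≤-by le (trans (cong (λ s → h zero + (g zero + s)) (∑-cong λ l → same (suc l) λ ()))
      (solve 3 (λ g h s → h :+ (g :+ s) ⊜ g :+ (h :+ s)) refl (g zero) (h zero) (∑ R (h ∘ suc))))
  ∑-cancel {suc m} {g} {h} (suc i) same le =
    ∑-cancel i (λ l l≢i → same (suc l) λ { refl → l≢i refl })
      (≤-by le (trans (cong (λ c → ∑ R (h ∘ suc) + (c + ∑ R (g ∘ suc))) (same zero λ ()))
        (solve 3 (λ g h c → h :+ (c :+ g) ⊜ g :+ (c :+ h)) refl (∑ R (g ∘ suc)) (∑ R (h ∘ suc)) (h zero))))

  module _ {k : ℕ} {A : Set} (B : Fin k → A) (i : Fin k) (X : A) where

    replace : Fin k → A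
    replace l = if does (l ≟ i) then X else B l

    replace-same : replace i ≡ X
    replace-same = if-yes (i ≟ i) refl

    replace-other : ∀ {l} → l ≢ i → replace l ≡ B l
    replace-other {l} = if-no (l ≟ i)

    replace-all : (P : Fin k → A → Set) → P i X → (∀ l → P l (B l)) → ∀ l → P l (replace l)
    replace-all P p q l with l ≟ i
    ... | yes refl = p
    ... | no _     = q l

  module _ {n k : ℕ} (M : Fin k → Matroid n) (μ : Fin k → Subset n → ℝ) (u : Fin n → ℝ) where

    private
      total : (Fin k → Subset n) → ℝ
      total B = ∑ R (λ l → wt (M l) (μ l) u (B l))

      total-≡ : ∀ B → total B ≡ sumWeight R μ B + pair R u B
      total-≡ B = ∑-+ (λ l → μ l (B l)) (λ l → pairSet R u (B l))

    module _ (N : Fin k → Matroid n) (spec : ∀ B → Cell R M (sumWeight R μ) u B ⇔ (∀ i → IsBasis (N i) (B i))) where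

      private
        B* : Fin k → Subset n
        B* l = proj₁ (nonempty (N l))

        -- With `X` at position `i` of the fixed tuple `B*`, the result lies in the cell. Comparing
        -- it with tuples that differ only at `i` cancels all other terms.
        N⇒min : ∀ i X → IsBasis (N i) X → IsMin (M i) (μ i) u X
        N⇒min i X x = subst (IsBasis (M i)) (replace-same B* i X) (proj₁ cell i) , minimal
          where
          cell : Cell R M (sumWeight R μ) u (replace B* i X)
          cell = proj₂ (spec _) (replace-all B* i X (λ l → IsBasis (N l)) x (λ l → proj₂ (nonempty (N l))))
          minimal : ∀ Y → IsBasis (M i) Y → wt (M i) (μ i) u X ≤ᴿ wt (M i) (μ i) u Y
          minimal Y y = subst₂ (λ X Y → wt (M i) (μ i) u X ≤ᴿ wt (M i) (μ i) u Y) (replace-same B* i X) (replace-same B* i Y)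
            (∑-cancel i (λ l l≢i → cong (wt (M l) (μ l) u) (trans (replace-other B* i X l≢i) (sym (replace-other B* i Y l≢i))))
              (subst₂ _≤ᴿ_ (sym (total-≡ _)) (sym (total-≡ _)) (proj₂ cell (replace B* i Y)
                (replace-all B* i Y (λ l → IsBasis (M l)) y (proj₁ (proj₂ (spec B*) (λ l → proj₂ (nonempty (N l)))))))))

        -- A tuple of coordinatewise minimisers minimises the sum, so it lies in the cell.
        min⇒N : ∀ i X → IsMin (M i) (μ i) u X → IsBasis (N i) X
        min⇒N i X X-min = subst (IsBasis (N i)) (replace-same B* i X)
          (proj₁ (spec _) ((λ l → proj₁ (all-min l)) , λ B′ b′ →
            subst₂ _≤ᴿ_ (total-≡ _) (total-≡ B′) (∑-mono λ l → proj₂ (all-min l) (B′ l) (b′ l))) i)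
          where
          all-min : ∀ l → IsMin (M l) (μ l) u (replace B* i X l)
          all-min = replace-all B* i X (λ l → IsMin (M l) (μ l) u) X-min (λ l → N⇒min l (B* l) (proj₂ (nonempty (N l))))

      factor-initial : ∀ i X → IsMin (M i) (μ i) u X ⇔ IsBasis (N i) X
      factor-initial i X = min⇒N i X , N⇒min i X

  -- From the flag matroidal subdivision to the inclusions

  FlagInitial : ∀ {n k} → (Fin k → Matroid n) → (Fin k → Subset n → ℝ) → Set
  FlagInitial {n} {k} M μ = ∀ u → ∃[ N ] (IsFlag {n} {k} N × (∀ i X → IsMin (M i) (μ i) u X ⇔ IsBasis (N i) X))

  -- The cell of the sum at `u` is a cell of `w`, possibly at another weight `u′`, and the flag
  -- matroid there has the sets of minimisers of the summands as its bases.
  flag-initial : ∀ {n k} (M : Fin k → Matroid n) w → FlagMatroidal R M w → ∀ μ → SameSubdivision R M w (sumWeight R μ) →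
    FlagInitial M μ
  flag-initial M w flagMatroidal μ (_ , same) u with same u
  ... | u′ , cells with flagMatroidal u′
  ...   | N , flag , spec = N , flag , factor-initial M μ u N λ B →
    (λ c → proj₁ (spec B) (proj₁ (cells B) c)) , (λ b → proj₂ (cells B) (proj₂ (spec B) b))

  module _ {n k : ℕ} (M : Fin k → Matroid n) (μ : Fin k → Subset n → ℝ) (initial : FlagInitial M μ) where

    exchanges : ∀ i → ValuatedExchange (M i) (μ i)
    exchanges i = valuated-exchange {M = M i} λ u → proj₁ (initial u) i , proj₂ (proj₂ (initial u)) i

    module _ {i j : Fin k} (i<j : i <ᶠ j) (S : Subset n) (u : Fin n → ℝ) where

      private
        Dominates : Fin k → ℝ → Set
        Dominates l L = ∀ X Y → ∣ X ∩ S ∣ ℕ.< ∣ Y ∩ S ∣ →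
          wt (M l) (μ l) (direction S u L) Y < wt (M l) (μ l) (direction S u L) X

        -- Both initial matroids have to come from one flag, hence from one weight; the larger of
        -- the two bonuses suits both.
        common-bonus : ∃[ L ] (Dominates i L × Dominates j L)
        common-bonus with large-bonus (M i) (μ i) (neg ∘ u) S | large-bonus (M j) (μ j) (neg ∘ u) S
        ... | L , large | L′ , large′ with O.total L L′
        ...   | inj₁ L≤L′ = L′ , proj₂ (large L′ L≤L′) , proj₂ (large′ L′ O.refl)
        ...   | inj₂ L′≤L = L , proj₂ (large L O.refl) , proj₂ (large′ L L′≤L)

      -- The circuit condition for `i` is turned into coverage by minimisers, carried to `j` by
      -- `flag-nonloop`, and turned back for the contraction built from a minimiser of `j`.
      trop-mono : ∀ {ν} → IsContraction R (extend R (M i) (μ i)) S ν → InTrop R ν S u →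
        ∃[ ν′ ] (IsContraction R (extend R (M j) (μ j)) S ν′ × InTrop R ν′ S u)
      trop-mono contraction trop with common-bonus
      ... | L , large , large′ with initial (direction S u L)
      ...   | N , flag , spec = contract {M = M j} (exchanges j) S u L large′ B₀-max ,
        contract-isContraction {M = M j} (exchanges j) S u L large′ B₀-max ,
        covered⇒trop {M = M j} (exchanges j) S u L large′ B₀-max covered
        where
        B₀-max : MaxOn (M j) S (proj₁ (nonempty (N j)))
        B₀-max = min⇒MaxOn {M = M j} (exchanges j) S u L large′ (proj₂ (spec j _) (proj₂ (nonempty (N j))))
        covered : Covered {M = M j} (exchanges j) S u L large′
        covered e e∉S with trop⇒covered {M = M i} (exchanges i) S u L large (proj₂ (spec i _) (proj₂ (nonempty (N i)))) contraction trop e e∉S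
        ... | X , X-min , e∈X with flag-nonloop {N = N} flag i<j (proj₁ (spec i X) X-min) e∈X
        ...   | Y , y , e∈Y = Y , proj₂ (spec j Y) y , e∈Y

theorem4p20 : (R : RealLine) → let open RealLine R using (ℝ) in
    ∀ {n k : ℕ} (M : Fin k → Matroid n) → IsFlag M →
    (w : (Fin k → Subset n) → ℝ) → FlagMatroidal R M w →
    (μ : Fin k → Subset n → ℝ) → SameSubdivision R M w (sumWeight R μ) →
    (∀ i → IsValuatedMatroid R (extend R (M i) (μ i))) ×
    (∀ (i j : Fin k) → i ≤ j → ∀ (x : Fin n → 𝕋 R) →
    InTropBar R (extend R (M i) (μ i)) x → InTropBar R (extend R (M j) (μ j)) x)
theorem4p20 R {n} {k} M _ w flagMatroidal μ same =
  (λ i → extend-exchange R (M i) (μ i) (exchanges R M μ initial i)) , inclusion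
  where
  initial : FlagInitial R M μ
  initial = flag-initial R M w flagMatroidal μ same
  inclusion : ∀ (i j : Fin k) → i ≤ j → ∀ (x : Fin n → 𝕋 R) →
    InTropBar R (extend R (M i) (μ i)) x → InTropBar R (extend R (M j) (μ j)) x
  inclusion i j i≤j x inBar@(finite , ν , contraction , trop) with i ≟ j
  ... | yes refl = inBar
  ... | no i≢j   = finite , trop-mono R M μ initial (≤∧≢⇒< i≤j i≢j) (tabulate (λ e → is-nothing (x e)))
                     (λ e → fromMaybe _ (x e)) contraction trop
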